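{- Let $(X,d)$ be a finite tree-like pseudometric space, and let $(\mathcal S,\alpha)$ be the unique positively weighted system of compatible splits of $X$ with $d=d_\alpha$. Then $$\operatorname{LIP}(X,d)=\sum_{\sigma\in\mathcal S}\alpha_\sigma S_\sigma$$ (Minkowski sum); in particular $\operatorname{LIP}(X,d)$ is a zonotope.
   Context: Let $X$ be a finite set, $n:=|X|$, $\{\mathbbm 1_k\}$ the standard basis of $\mathbb R^X$, $\mathbbm 1_A:=\sum_{x\in A}\mathbbm 1_x$. A split of $X$ is an unordered pair of nonempty disjoint subsets $A,B$ with $A\cup B=X$, written $A|B$. Splits $A|B$ and $C|D$ are compatible if at least one of $A\cap C,A\cap D,B\cap C,B\cap D$ is empty; a system of splits is compatible if its elements are pairwise compatible. For $\sigma=A|B$, $\delta_\sigma(i,j)=0$ if $i,j$ are in the same side, $1$ otherwise; for $\alpha\in\mathbb R_{\ge0}^{\mathcal S}$, $d_\alpha:=\sum_{\sigma\in\mathcal S}\alpha_\sigma\delta_\sigma$; the weighting is positive if all $\alpha_\sigma>0$. $S_\sigma:=\operatorname{conv}\{\tfrac{|B|}{n}\mathbbm 1_A-\tfrac{|A|}{n}\mathbbm 1_B,\ \tfrac{|A|}{n}\mathbbm 1_B-\tfrac{|B|}{n}\mathbbm 1_A\}$. For a pseudometric $d$, $\operatorname{LIP}(X,d):=\{x\in\mathbb R^X\mid\sum_i x_i=0,\ x_i-x_j\le d(i,j)\ \forall i,j\}$. An $X$-tree is a pair $(T,\phi)$ with $T$ a finite tree and $\phi:X\to V(T)$ a map whose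 image contains every vertex of degree at most $2$. A pseudometric $d$ on $X$ is tree-like if there are an $X$-tree $(T,\phi)$ and edge weights $w:E(T)\to\mathbb R_{>0}$ such that $d(x,y)$ equals the total weight of the unique path in $T$ from $\phi(x)$ to $\phi(y)$. It is known (and may be used) that a pseudometric is tree-like if and only if it equals $d_\alpha$ for a positively weighted compatible split system $(\mathcal S,\alpha)$, and that this system is unique; its splits correspond bijectively to edges of $T$ (the split of an edge $e$ separates the preimages under $\phi$ of the two components of $T-e$). -}

module Defs where

open import Data.Bool using (if_then_else_)
open import Data.Fin using (Fin)
open import Data.Fin.Properties using (nonZeroIndex)
open import Data.Fin.Subset using (Subset; _∈_; _∉_; _∩_; _∪_; ⊤; ∣_∣; Nonempty; Empty)
open import Data.Fin.Subset.Properties using (_∈?_)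
open import Data.Integer using (+_)
open import Data.List using (List; []; _∷_)
open import Data.List.Relation.Unary.Unique.Propositional using (Unique)
open import Data.Nat as ℕ using (ℕ; NonZero)
import Data.Nat.Properties as ℕₚ
open import Data.Product using (Σ-syntax; ∃-syntax; _×_; _,_; proj₁)
open import Data.Rational as ℚ using (ℚ; 0ℚ; 1ℚ; ½)
import Data.Rational.Properties as ℚₚ
open import Data.Rational.Solver using (module +-*-Solver)
open import Data.Sum using (_⊎_)
import Data.Vec.Functional as VF
open import Level using (0ℓ)
open import Relation.Binary.PropositionalEquality using (_≡_; refl; sym; trans; cong; subst)
open import Relation.Nullary using (Dec; does)
open import Relation.Nullary.Decidable using (_×-dec_; _⊎-dec_)
open import Relation.Unary using (Pred; _≐_)

-- Real numbers are Cauchy sequences of rationals, and _≈_ (their difference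
-- tends to 0) is their equality.

IsCauchy : (ℕ → ℚ) → Set
IsCauchy s = ∀ ε → 0ℚ ℚ.< ε →
  ∃[ N ] ∀ j k → N ℕ.≤ j → N ℕ.≤ k → ℚ.∣ s j ℚ.- s k ∣ ℚ.≤ ε

record ℝ : Set where
  constructor mkℝ
  field
    seq    : ℕ → ℚ
    cauchy : IsCauchy seq

open ℝ public

infix  4 _≈_ _≤_ _<_
infixl 6 _+_ _-_
infixl 7 _*_
infix  8 -_

_≈_ : ℝ → ℝ → Set
x ≈ y = ∀ ε → 0ℚ ℚ.< ε →
  ∃[ N ] ∀ k → N ℕ.≤ k → ℚ.∣ seq x k ℚ.- seq y k ∣ ℚ.≤ ε

_≤_ : ℝ → ℝ → Set
x ≤ y = ∀ ε → 0ℚ ℚ.< ε →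
  ∃[ N ] ∀ k → N ℕ.≤ k → seq x k ℚ.≤ seq y k ℚ.+ ε

_<_ : ℝ → ℝ → Set
x < y = ∃[ ε ] (0ℚ ℚ.< ε) ×
  ∃[ N ] ∀ k → N ℕ.≤ k → seq x k ℚ.+ ε ℚ.≤ seq y k

open +-*-Solver
open ℚₚ.≤-Reasoning

abstract

  sum-diff : ∀ a b c d → (a ℚ.+ b) ℚ.- (c ℚ.+ d) ≡ (a ℚ.- c) ℚ.+ (b ℚ.- d)
  sum-diff = solve 4 (λ a b c d → (a :+ b) :- (c :+ d) := (a :- c) :+ (b :- d)) refl

  neg-diff : ∀ a b → (ℚ.- a) ℚ.- (ℚ.- b) ≡ ℚ.- (a ℚ.- b)
  neg-diff = solve 2 (λ a b → (:- a) :- (:- b) := :- (a :- b)) refl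

  diff-add : ∀ a b → a ≡ (a ℚ.- b) ℚ.+ b
  diff-add = solve 2 (λ a b → a := (a :- b) :+ b) refl

  prod-diff : ∀ a b c d →
    a ℚ.* b ℚ.- c ℚ.* d ≡ a ℚ.* (b ℚ.- d) ℚ.+ d ℚ.* (a ℚ.- c)
  prod-diff = solve 4 (λ a b c d →
    a :* b :- c :* d := a :* (b :- d) :+ d :* (a :- c)) refl

  factor : ∀ b c e i → b ℚ.* (e ℚ.* i) ℚ.+ c ℚ.* (e ℚ.* i) ≡ e ℚ.* ((b ℚ.+ c) ℚ.* i)
  factor = solve 4 (λ b c e i →
    b :* (e :* i) :+ c :* (e :* i) := e :* ((b :+ c) :* i)) refl

  const-cauchy : ∀ q → IsCauchy (λ _ → q)
  const-cauchy q ε 0<ε = 0 , λ _ _ _ _ →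
    subst (ℚ._≤ ε) (sym (cong ℚ.∣_∣ (ℚₚ.+-inverseʳ q))) (ℚₚ.<⇒≤ 0<ε)

  ½-pos : ∀ {ε} → 0ℚ ℚ.< ε → 0ℚ ℚ.< ½ ℚ.* ε
  ½-pos {ε} 0<ε =
    ℚₚ.positive⁻¹ (½ ℚ.* ε) {{ℚₚ.pos*pos⇒pos ½ ε {{ℚ.positive 0<ε}}}}

  ½+½ : ∀ ε → ½ ℚ.* ε ℚ.+ ½ ℚ.* ε ≡ ε
  ½+½ ε = trans (sym (ℚₚ.*-distribʳ-+ ε ½ ½)) (ℚₚ.*-identityˡ ε)

  +-cauchy : ∀ {s t} → IsCauchy s → IsCauchy t → IsCauchy (λ k → s k ℚ.+ t k)
  +-cauchy {s} {t} cs ct ε 0<ε with cs (½ ℚ.* ε) (½-pos 0<ε) | ct (½ ℚ.* ε) (½-pos 0<ε)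
  ... | M , p | N , q = M ℕ.⊔ N , λ j k h h′ → begin
    ℚ.∣ (s j ℚ.+ t j) ℚ.- (s k ℚ.+ t k) ∣
      ≡⟨ cong ℚ.∣_∣ (sum-diff (s j) (t j) (s k) (t k)) ⟩
    ℚ.∣ (s j ℚ.- s k) ℚ.+ (t j ℚ.- t k) ∣
      ≤⟨ ℚₚ.∣p+q∣≤∣p∣+∣q∣ (s j ℚ.- s k) (t j ℚ.- t k) ⟩
    ℚ.∣ s j ℚ.- s k ∣ ℚ.+ ℚ.∣ t j ℚ.- t k ∣
      ≤⟨ ℚₚ.+-mono-≤ (p j k (ℕₚ.m⊔n≤o⇒m≤o M N h) (ℕₚ.m⊔n≤o⇒m≤o M N h′))
                     (q j k (ℕₚ.m⊔n≤o⇒n≤o M N h) (ℕₚ.m⊔n≤o⇒n≤o M N h′)) ⟩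
    ½ ℚ.* ε ℚ.+ ½ ℚ.* ε
      ≡⟨ ½+½ ε ⟩
    ε ∎

  neg-cauchy : ∀ {s} → IsCauchy s → IsCauchy (λ k → ℚ.- s k)
  neg-cauchy {s} cs ε 0<ε with cs ε 0<ε
  ... | N , p = N , λ j k h h′ → begin
    ℚ.∣ (ℚ.- s j) ℚ.- (ℚ.- s k) ∣
      ≡⟨ cong ℚ.∣_∣ (neg-diff (s j) (s k)) ⟩
    ℚ.∣ ℚ.- (s j ℚ.- s k) ∣
      ≡⟨ ℚₚ.∣-p∣≡∣p∣ (s j ℚ.- s k) ⟩
    ℚ.∣ s j ℚ.- s k ∣
      ≤⟨ p j k h h′ ⟩
    ε ∎

  bounded : ∀ {s} → IsCauchy s →
    ∃[ B ] (0ℚ ℚ.< B) × ∃[ N ] ∀ k → N ℕ.≤ k → ℚ.∣ s k ∣ ℚ.≤ B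
  bounded {s} cs with cs 1ℚ (ℚₚ.positive⁻¹ 1ℚ)
  ... | N , p = 1ℚ ℚ.+ ℚ.∣ s N ∣
    , ℚₚ.+-mono-<-≤ (ℚₚ.positive⁻¹ 1ℚ) (ℚₚ.0≤∣p∣ (s N))
    , N , λ k h → begin
      ℚ.∣ s k ∣
        ≡⟨ cong ℚ.∣_∣ (diff-add (s k) (s N)) ⟩
      ℚ.∣ (s k ℚ.- s N) ℚ.+ s N ∣
        ≤⟨ ℚₚ.∣p+q∣≤∣p∣+∣q∣ (s k ℚ.- s N) (s N) ⟩
      ℚ.∣ s k ℚ.- s N ∣ ℚ.+ ℚ.∣ s N ∣
        ≤⟨ ℚₚ.+-monoˡ-≤ ℚ.∣ s N ∣ (p k N h ℕₚ.≤-refl) ⟩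
      1ℚ ℚ.+ ℚ.∣ s N ∣ ∎

  ∣*∣-mono : ∀ {p q r s} → 0ℚ ℚ.< r → ℚ.∣ p ∣ ℚ.≤ r → ℚ.∣ q ∣ ℚ.≤ s →
    ℚ.∣ p ℚ.* q ∣ ℚ.≤ r ℚ.* s
  ∣*∣-mono {p} {q} {r} {s} 0<r p≤r q≤s = begin
    ℚ.∣ p ℚ.* q ∣
      ≡⟨ ℚₚ.∣p*q∣≡∣p∣*∣q∣ p q ⟩
    ℚ.∣ p ∣ ℚ.* ℚ.∣ q ∣
      ≤⟨ ℚₚ.*-monoʳ-≤-nonNeg ℚ.∣ q ∣ {{ℚ.nonNegative (ℚₚ.0≤∣p∣ q)}} p≤r ⟩
    r ℚ.* ℚ.∣ q ∣
      ≤⟨ ℚₚ.*-monoˡ-≤-nonNeg r {{ℚ.nonNegative (ℚₚ.<⇒≤ 0<r)}} q≤s ⟩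
    r ℚ.* s ∎

  reciprocal : ∀ D → 0ℚ ℚ.< D → ∃[ i ] (0ℚ ℚ.< i) × (D ℚ.* i ≡ 1ℚ)
  reciprocal D 0<D =
    (ℚ.1/ D) {{nz}} , ℚₚ.positive⁻¹ _ {{ℚₚ.1/pos⇒pos D {{pos}}}} , ℚₚ.*-inverseʳ D {{nz}}
    where
    pos : ℚ.Positive D
    pos = ℚ.positive 0<D

    nz : ℚ.NonZero D
    nz = ℚₚ.pos⇒nonZero D {{pos}}

  rescale : ∀ B C ε → 0ℚ ℚ.< B → 0ℚ ℚ.< C → 0ℚ ℚ.< ε →
    ∃[ η ] (0ℚ ℚ.< η) × (B ℚ.* η ℚ.+ C ℚ.* η ≡ ε)
  rescale B C ε 0<B 0<C 0<ε with reciprocal (B ℚ.+ C) (ℚₚ.+-mono-< 0<B 0<C)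
  ... | i , 0<i , inverse = ε ℚ.* i
    , ℚₚ.positive⁻¹ (ε ℚ.* i)
        {{ℚₚ.pos*pos⇒pos ε {{ℚ.positive 0<ε}} i {{ℚ.positive 0<i}}}}
    , trans (factor B C ε i) (trans (cong (ε ℚ.*_) inverse) (ℚₚ.*-identityʳ ε))

  product-bound : ∀ a b c d B C η → 0ℚ ℚ.< B → 0ℚ ℚ.< C →
    ℚ.∣ a ∣ ℚ.≤ B → ℚ.∣ d ∣ ℚ.≤ C → ℚ.∣ a ℚ.- c ∣ ℚ.≤ η → ℚ.∣ b ℚ.- d ∣ ℚ.≤ η →
    ℚ.∣ a ℚ.* b ℚ.- c ℚ.* d ∣ ℚ.≤ B ℚ.* η ℚ.+ C ℚ.* η
  product-bound a b c d B C η 0<B 0<C a≤B d≤C a-c≤η b-d≤η = begin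
    ℚ.∣ a ℚ.* b ℚ.- c ℚ.* d ∣
      ≡⟨ cong ℚ.∣_∣ (prod-diff a b c d) ⟩
    ℚ.∣ a ℚ.* (b ℚ.- d) ℚ.+ d ℚ.* (a ℚ.- c) ∣
      ≤⟨ ℚₚ.∣p+q∣≤∣p∣+∣q∣ (a ℚ.* (b ℚ.- d)) (d ℚ.* (a ℚ.- c)) ⟩
    ℚ.∣ a ℚ.* (b ℚ.- d) ∣ ℚ.+ ℚ.∣ d ℚ.* (a ℚ.- c) ∣
      ≤⟨ ℚₚ.+-mono-≤ (∣*∣-mono {a} {b ℚ.- d} 0<B a≤B b-d≤η)
                     (∣*∣-mono {d} {a ℚ.- c} 0<C d≤C a-c≤η) ⟩
    B ℚ.* η ℚ.+ C ℚ.* η ∎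

  *-cauchy : ∀ {s t} → IsCauchy s → IsCauchy t → IsCauchy (λ k → s k ℚ.* t k)
  *-cauchy {s} {t} cs ct ε 0<ε =
    let B , 0<B , K , b     = bounded {s} cs
        C , 0<C , L , c     = bounded {t} ct
        η , 0<η , Bη+Cη≡ε   = rescale B C ε 0<B 0<C 0<ε
        M , p               = cs η 0<η
        N , q               = ct η 0<η
    in (K ℕ.⊔ L) ℕ.⊔ (M ℕ.⊔ N) , λ j k h h′ →
      let h₁  = ℕₚ.m⊔n≤o⇒m≤o (K ℕ.⊔ L) (M ℕ.⊔ N) h
          h₁′ = ℕₚ.m⊔n≤o⇒m≤o (K ℕ.⊔ L) (M ℕ.⊔ N) h′
          h₂  = ℕₚ.m⊔n≤o⇒n≤o (K ℕ.⊔ L) (M ℕ.⊔ N) h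
          h₂′ = ℕₚ.m⊔n≤o⇒n≤o (K ℕ.⊔ L) (M ℕ.⊔ N) h′
      in subst (ℚ.∣ s j ℚ.* t j ℚ.- s k ℚ.* t k ∣ ℚ.≤_) Bη+Cη≡ε
        (product-bound (s j) (t j) (s k) (t k) B C η 0<B 0<C
          (b j (ℕₚ.m⊔n≤o⇒m≤o K L h₁)) (c k (ℕₚ.m⊔n≤o⇒n≤o K L h₁′))
          (p j k (ℕₚ.m⊔n≤o⇒m≤o M N h₂) (ℕₚ.m⊔n≤o⇒m≤o M N h₂′))
          (q j k (ℕₚ.m⊔n≤o⇒n≤o M N h₂) (ℕₚ.m⊔n≤o⇒n≤o M N h₂′)))

fromℚ : ℚ → ℝ
fromℚ q = mkℝ (λ _ → q) (const-cauchy q)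

0ℝ : ℝ
0ℝ = fromℚ 0ℚ

1ℝ : ℝ
1ℝ = fromℚ 1ℚ

_+_ : ℝ → ℝ → ℝ
x + y = mkℝ (λ k → seq x k ℚ.+ seq y k) (+-cauchy {seq x} {seq y} (cauchy x) (cauchy y))

-_ : ℝ → ℝ
- x = mkℝ (λ k → ℚ.- seq x k) (neg-cauchy {seq x} (cauchy x))

_-_ : ℝ → ℝ → ℝ
x - y = x + (- y)

_*_ : ℝ → ℝ → ℝ
x * y = mkℝ (λ k → seq x k ℚ.* seq y k) (*-cauchy {seq x} {seq y} (cauchy x) (cauchy y))

∑ : ∀ {m} → (Fin m → ℝ) → ℝ
∑ = VF.foldr _+_ 0ℝ

-- Subsets of ℝⁿ are predicates, compared by _≐_; as elements of ℝⁿ are compared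
-- by _≋_, the predicates below are closed under it.

infix  4 _≋_
infixl 6 _⊖_
infixr 7 _·_ _⋆_

ℝ^ : ℕ → Set
ℝ^ n = Fin n → ℝ

_≋_ : ∀ {n} → ℝ^ n → ℝ^ n → Set
x ≋ y = ∀ i → x i ≈ y i

_⊖_ : ∀ {n} → ℝ^ n → ℝ^ n → ℝ^ n
(x ⊖ y) i = x i - y i

_·_ : ∀ {n} → ℝ → ℝ^ n → ℝ^ n
(c · x) i = c * x i

∑ᵛ : ∀ {m n} → (Fin m → ℝ^ n) → ℝ^ n
∑ᵛ u i = ∑ (λ k → u k i)

PointSet : ℕ → Set₁
PointSet n = Pred (ℝ^ n) 0ℓ

conv : ∀ {m n} → (Fin m → ℝ^ n) → PointSet n
conv {m} u x = Σ[ c ∈ (Fin m → ℝ) ]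
  (∀ k → 0ℝ ≤ c k) × (∑ c ≈ 1ℝ) × (x ≋ ∑ᵛ (λ k → c k · u k))

segment : ∀ {n} → ℝ^ n → ℝ^ n → PointSet n
segment p q = conv (p VF.∷ q VF.∷ VF.[])

_⋆_ : ∀ {n} → ℝ → PointSet n → PointSet n
(c ⋆ P) x = ∃[ y ] P y × (x ≋ c · y)

MinkowskiSum : ∀ {m n} → (Fin m → PointSet n) → PointSet n
MinkowskiSum {m} {n} P x = Σ[ y ∈ (Fin m → ℝ^ n) ] (∀ k → P k (y k)) × (x ≋ ∑ᵛ y)

IsZonotope : ∀ {n} → PointSet n → Set
IsZonotope {n} P = ∃[ m ] Σ[ p ∈ (Fin m → ℝ^ n) ] Σ[ q ∈ (Fin m → ℝ^ n) ]
  P ≐ MinkowskiSum (λ k → segment (p k) (q k))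

-- The finite set X is Fin n.

record IsPseudometric {n} (d : Fin n → Fin n → ℝ) : Set where
  field
    nonneg   : ∀ i j → 0ℝ ≤ d i j
    diag     : ∀ i → d i i ≈ 0ℝ
    symm     : ∀ i j → d i j ≈ d j i
    triangle : ∀ i j k → d i k ≤ d i j + d j k

LIP : ∀ {n} → (Fin n → Fin n → ℝ) → PointSet n
LIP d x = (∑ x ≈ 0ℝ) × (∀ i j → x i - x j ≤ d i j)

record Split (n : ℕ) : Set where
  field
    A B        : Subset n
    A-nonempty : Nonempty A
    B-nonempty : Nonempty B
    disjoint   : Empty (A ∩ B)
    cover      : A ∪ B ≡ ⊤

-- Splits are unordered: this, not _≡_, is equality of splits.
_≈ˢ_ : ∀ {n} → Split n → Split n → Set
σ ≈ˢ τ = (σ.A ≡ τ.A × σ.B ≡ τ.B) ⊎ (σ.A ≡ τ.B × σ.B ≡ τ.A)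
  where
  module σ = Split σ
  module τ = Split τ

Compatible : ∀ {n} → Split n → Split n → Set
Compatible σ τ =
  Empty (σ.A ∩ τ.A) ⊎ Empty (σ.A ∩ τ.B) ⊎ Empty (σ.B ∩ τ.A) ⊎ Empty (σ.B ∩ τ.B)
  where
  module σ = Split σ
  module τ = Split τ

-- A finite set of splits is given by an enumeration without repetition.
record IsCompatibleSplitSystem {m n} (S : Fin m → Split n) : Set where
  field
    distinct   : ∀ {k l} → S k ≈ˢ S l → k ≡ l
    compatible : ∀ k l → Compatible (S k) (S l)

SameSide : ∀ {n} → Split n → Fin n → Fin n → Set
SameSide σ i j = (i ∈ A × j ∈ A) ⊎ (i ∈ B × j ∈ B)
  where open Split σ

sameSide? : ∀ {n} (σ : Split n) i j → Dec (SameSide σ i j)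
sameSide? σ i j = (i ∈? A ×-dec j ∈? A) ⊎-dec (i ∈? B ×-dec j ∈? B)
  where open Split σ

δ : ∀ {n} → Split n → Fin n → Fin n → ℝ
δ σ i j = if does (sameSide? σ i j) then 0ℝ else 1ℝ

d[_,_] : ∀ {m n} → (Fin m → Split n) → (Fin m → ℝ) → Fin n → Fin n → ℝ
d[ S , α ] i j = ∑ (λ k → α k * δ (S k) i j)

𝟙 : ∀ {n} → Subset n → ℝ^ n
𝟙 C i = if does (i ∈? C) then 1ℝ else 0ℝ

S⟨_⟩ : ∀ {n} → Split n → PointSet n
S⟨_⟩ {n} σ = segment (∣B∣/n · 𝟙 A ⊖ ∣A∣/n · 𝟙 B) (∣A∣/n · 𝟙 B ⊖ ∣B∣/n · 𝟙 A)
  where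
  open Split σ

  instance
    n-nonZero : NonZero n
    n-nonZero = nonZeroIndex (proj₁ A-nonempty)

  ∣A∣/n ∣B∣/n : ℝ
  ∣A∣/n = fromℚ (+ ∣ A ∣ ℚ./ n)
  ∣B∣/n = fromℚ (+ ∣ B ∣ ℚ./ n)

record Graph : Set where
  field
    order  : ℕ
    nbrs   : Fin order → Subset order
    symm   : ∀ {u v} → v ∈ nbrs u → u ∈ nbrs v
    irrefl : ∀ u → u ∉ nbrs u

  Vertex : Set
  Vertex = Fin order

  degree : Vertex → ℕ
  degree u = ∣ nbrs u ∣

  data Walk : Vertex → Vertex → Set where
    []   : ∀ {u} → Walk u u
    cons : ∀ {u v t} → v ∈ nbrs u → Walk v t → Walk u t

  vertices : ∀ {u v} → Walk u v → List Vertex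
  vertices {u} []         = u ∷ []
  vertices {u} (cons _ p) = u ∷ vertices p

  length : ∀ {u v} → Walk u v → ℕ
  length []         = 0
  length (cons _ p) = ℕ.suc (length p)

  IsPath : ∀ {u v} → Walk u v → Set
  IsPath p = Unique (vertices p)

  -- A cycle is a path of length at least 2 together with an edge joining
  -- its two ends.
  record IsTree : Set where
    field
      nonempty  : NonZero order
      connected : ∀ u v → Σ[ p ∈ Walk u v ] IsPath p
      acyclic   : ∀ {u v} (p : Walk u v) → IsPath p → 2 ℕ.≤ length p → v ∉ nbrs u

  -- Values of an edge weighting off the edges are irrelevant.
  record IsPositiveWeighting (w : Vertex → Vertex → ℝ) : Set where
    field
      w-symm : ∀ {u v} → v ∈ nbrs u → w u v ≈ w v u
      w-pos  : ∀ {u v} → v ∈ nbrs u → 0ℝ < w u v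

  weight : (Vertex → Vertex → ℝ) → ∀ {u v} → Walk u v → ℝ
  weight w []                 = 0ℝ
  weight w (cons {u} {v} _ p) = w u v + weight w p

record XTree (n : ℕ) : Set where
  field
    graph    : Graph
  open Graph graph public
  field
    isTree   : IsTree
    φ        : Fin n → Vertex
    labelled : ∀ v → degree v ℕ.≤ 2 → ∃[ x ] φ x ≡ v

-- The path from φ x to φ y exists and is unique because the graph is a tree.
TreeLike : ∀ {n} → (Fin n → Fin n → ℝ) → Set
TreeLike {n} d = Σ[ T ∈ XTree n ] (let open XTree T in
  Σ[ w ∈ (Vertex → Vertex → ℝ) ] IsPositiveWeighting w ×
  (∀ x y (p : Walk (φ x) (φ y)) → IsPath p → d x y ≈ weight w p))

{-# OPTIONS --safe #-}

-- The splits are removed one at a time. Let d = a δ_σ + e with σ = A|B, and let x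
-- be 1-Lipschitz for d. A multiple β of the direction of S_σ has to be subtracted
-- from x so that the rest is 1-Lipschitz for e. Every pair i ∈ A, j ∈ B bounds β
-- from below by x_i − x_j − e(i,j) and from above by e(j,i) + x_i − x_j, and such
-- a β exists, with |β| ≤ a, if for i, i′ ∈ A and j, j′ ∈ B
--   e(i,i′) + e(j′,j) ≤ e(i,j) + e(j′,i′).
-- This holds for δ_τ when τ is compatible with σ, since τ then cannot separate
-- both i from i′ and j from j′; hence it holds for the sum e of the other splits.

module Submission where

open import Defs
open import Algebra.Bundles using (CommutativeRing)
open import Data.Bool using (Bool; true; false; not; _xor_; if_then_else_)
open import Data.Bool.Properties using (not-injective)
open import Data.Empty using (⊥-elim)
open import Data.Fin using (Fin; zero; suc)
open import Data.Fin.Properties using (nonZeroIndex)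
open import Data.Fin.Subset using (Subset; inside; outside; _∈_; _∩_; ∁; ∣_∣; Empty)
open import Data.Fin.Subset.Properties
  using (_∈?_; x∈p∩q⁺; x∈p∪q⁻; x∈∁p⇒x∉p; x∉p⇒x∈∁p; ∣∁p∣≡n∸∣p∣; ∣p∣≤n; ∈⊤; ⊆-antisym)
open import Data.Integer as ℤ using (+_)
import Data.Integer.Properties as ℤₚ
open import Data.Nat as ℕ using (ℕ)
import Data.Nat.Properties as ℕₚ
open import Data.Product using (∃-syntax; _×_; _,_; proj₁; proj₂)
open import Data.Rational as ℚ using (ℚ; 0ℚ; 1ℚ; ½)
import Data.Rational.Properties as ℚₚ
open import Data.Rational.Solver using (module +-*-Solver)
import Data.Rational.Unnormalised as ℚᵘ
import Data.Rational.Unnormalised.Properties as ℚᵘₚ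
open import Data.Sum using (_⊎_; inj₁; inj₂)
open import Data.Vec using ([]; _∷_)
import Data.Vec.Functional as VF
open import Level using (0ℓ)
open import Relation.Binary.Bundles using (Poset)
open import Relation.Binary.PropositionalEquality as ≡ using (_≡_)
open import Relation.Nullary using (does; yes; no; contradiction)
open import Relation.Unary using (_≐_; _⊆_)

open +-*-Solver

-- Real numbers

-- A lower bound on β from i′ in A, j′ in B meets an upper bound from i in B, j in A exactly when (x
-- i′ - x j) + (x i - x j′) ≤ e(i′,j′) + e(i,j). In this grouping each difference stays on one side
-- of σ, where δ_σ vanishes, so the left side is at most e(i′,j) + e(i,j′), and what remains is the
-- displayed inequality for e. The order on Cauchy reals cannot be decided, so β is not found by
-- cases or as an attained maximum. It is a supremum of finitely many reals, formed by termwise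
-- maxima and started at -a; the start yields -a ≤ β at once. Membership in a S_σ asks for a
-- coefficient t = β/a with |t| ≤ 1, hence the reciprocal of a positive real. For the converse
-- inclusion, S_σ lies in LIP(δ_σ), and Lipschitz bounds scale and add along with the points.

Eventually : (ℕ → Set) → Set
Eventually P = ∃[ N ] ∀ k → N ℕ.≤ k → P k

always : ∀ {P} → (∀ k → P k) → Eventually P
always p = 0 , λ k _ → p k

eventually-zip : ∀ {P Q R : ℕ → Set} → (∀ k → P k → Q k → R k) →
  Eventually P → Eventually Q → Eventually R
eventually-zip f (M , p) (N , q) = M ℕ.⊔ N , λ k h →
  f k (p k (ℕₚ.m⊔n≤o⇒m≤o M N h)) (q k (ℕₚ.m⊔n≤o⇒n≤o M N h))

eventually-map : ∀ {P Q : ℕ → Set} → (∀ k → P k → Q k) → Eventually P → Eventually Q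
eventually-map f (M , p) = M , λ k h → f k (p k h)

-- _≈_ and _≤_ unfold to function types, from which Agda cannot recover the two
-- reals; these wrappers make them inferable.

infix 4 _≃_ _≲_

record _≃_ (x y : ℝ) : Set where
  constructor ⌊_⌋
  field un≈ : x ≈ y

record _≲_ (x y : ℝ) : Set where
  constructor ⌊_⌋
  field un≤ : x ≤ y

open _≃_
open _≲_

opaque

  ∣∣-lub : ∀ {p r} → p ℚ.≤ r → ℚ.- p ℚ.≤ r → ℚ.∣ p ∣ ℚ.≤ r
  ∣∣-lub {p} {r} p≤r -p≤r with ℚₚ.∣p∣≡p∨∣p∣≡-p p
  ... | inj₁ eq = ≡.subst (ℚ._≤ r) (≡.sym eq) p≤r
  ... | inj₂ eq = ≡.subst (ℚ._≤ r) (≡.sym eq) -p≤r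

  p≤∣p∣ : ∀ p → p ℚ.≤ ℚ.∣ p ∣
  p≤∣p∣ p with ℚₚ.≤-total 0ℚ p
  ... | inj₁ 0≤p = ℚₚ.≤-reflexive (≡.sym (ℚₚ.0≤p⇒∣p∣≡p 0≤p))
  ... | inj₂ p≤0 = ℚₚ.≤-trans p≤0 (ℚₚ.0≤∣p∣ p)

  ≤+⇒-≤ : ∀ {p q r} → p ℚ.≤ q ℚ.+ r → p ℚ.- q ℚ.≤ r
  ≤+⇒-≤ {p} {q} {r} h = ≡.subst (p ℚ.- q ℚ.≤_)
    (solve 2 (λ q r → (q :+ r) :- q := r) ≡.refl q r) (ℚₚ.+-monoˡ-≤ (ℚ.- q) h)

  -≤⇒≤+ : ∀ {p q r} → p ℚ.- q ℚ.≤ r → p ℚ.≤ q ℚ.+ r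
  -≤⇒≤+ {p} {q} {r} h = ≡.subst (ℚ._≤ q ℚ.+ r)
    (solve 2 (λ p q → q :+ (p :- q) := p) ≡.refl p q) (ℚₚ.+-monoʳ-≤ q h)

  ∣-∣-comm : ∀ p q → ℚ.∣ p ℚ.- q ∣ ≡ ℚ.∣ q ℚ.- p ∣
  ∣-∣-comm p q = ≡.trans (≡.cong ℚ.∣_∣ (solve 2 (λ p q → p :- q := :- (q :- p)) ≡.refl p q))
    (ℚₚ.∣-p∣≡∣p∣ (q ℚ.- p))

  ∣-∣≤⇒≤+ : ∀ p q {r} → ℚ.∣ p ℚ.- q ∣ ℚ.≤ r → p ℚ.≤ q ℚ.+ r
  ∣-∣≤⇒≤+ p q h = -≤⇒≤+ (ℚₚ.≤-trans (p≤∣p∣ (p ℚ.- q)) h)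

  ≤+⇒∣-∣≤ : ∀ p q {r} → p ℚ.≤ q ℚ.+ r → q ℚ.≤ p ℚ.+ r → ℚ.∣ p ℚ.- q ∣ ℚ.≤ r
  ≤+⇒∣-∣≤ p q {r} h h′ = ∣∣-lub (≤+⇒-≤ h)
    (≡.subst (ℚ._≤ r) (solve 2 (λ p q → q :- p := :- (p :- q)) ≡.refl p q) (≤+⇒-≤ h′))

  pointwise-≃ : ∀ {x y} → (∀ k → seq x k ≡ seq y k) → x ≃ y
  pointwise-≃ {x} {y} h = ⌊ (λ ε 0<ε → always λ k → ≡.subst (λ q → ℚ.∣ q ℚ.- seq y k ∣ ℚ.≤ ε) (≡.sym (h k))
    (≡.subst (ℚ._≤ ε) (≡.sym (≡.cong ℚ.∣_∣ (ℚₚ.+-inverseʳ (seq y k)))) (ℚₚ.<⇒≤ 0<ε))) ⌋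

  pointwise-≲ : ∀ {x y} → (∀ k → seq x k ℚ.≤ seq y k) → x ≲ y
  pointwise-≲ {x} {y} h = ⌊ (λ ε 0<ε → always λ k → ℚₚ.≤-trans (h k)
    (≡.subst (ℚ._≤ seq y k ℚ.+ ε) (ℚₚ.+-identityʳ (seq y k)) (ℚₚ.+-monoʳ-≤ (seq y k) (ℚₚ.<⇒≤ 0<ε)))) ⌋

  ≲-reflexive : ∀ {x y} → x ≃ y → x ≲ y
  ≲-reflexive {x} {y} ⌊ h ⌋ = ⌊ (λ ε 0<ε → eventually-map (λ k → ∣-∣≤⇒≤+ (seq x k) (seq y k)) (h ε 0<ε)) ⌋

  ≲-antisym : ∀ {x y} → x ≲ y → y ≲ x → x ≃ y
  ≲-antisym {x} {y} ⌊ h ⌋ ⌊ h′ ⌋ = ⌊ (λ ε 0<ε →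
    eventually-zip (λ k → ≤+⇒∣-∣≤ (seq x k) (seq y k)) (h ε 0<ε) (h′ ε 0<ε)) ⌋

  ≲-trans : ∀ {x y z} → x ≲ y → y ≲ z → x ≲ z
  ≲-trans {x} {y} {z} ⌊ h ⌋ ⌊ h′ ⌋ = ⌊ (λ ε 0<ε → eventually-zip
    (λ k p q → ≡.subst (seq x k ℚ.≤_)
      (≡.trans (ℚₚ.+-assoc (seq z k) _ _) (≡.cong (seq z k ℚ.+_) (½+½ ε)))
      (ℚₚ.≤-trans p (ℚₚ.+-monoˡ-≤ (½ ℚ.* ε) q)))
    (h (½ ℚ.* ε) (½-pos 0<ε)) (h′ (½ ℚ.* ε) (½-pos 0<ε))) ⌋

  ≃-refl : ∀ {x} → x ≃ x
  ≃-refl = pointwise-≃ λ k → ≡.refl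

  ≃-sym : ∀ {x y} → x ≃ y → y ≃ x
  ≃-sym {x} {y} ⌊ h ⌋ = ⌊ (λ ε 0<ε → eventually-map
    (λ k → ≡.subst (ℚ._≤ ε) (∣-∣-comm (seq x k) (seq y k))) (h ε 0<ε)) ⌋

  ≃-trans : ∀ {x y z} → x ≃ y → y ≃ z → x ≃ z
  ≃-trans h h′ = ≲-antisym (≲-trans (≲-reflexive h) (≲-reflexive h′))
    (≲-trans (≲-reflexive (≃-sym h′)) (≲-reflexive (≃-sym h)))

  ≲-refl : ∀ {x} → x ≲ x
  ≲-refl = ≲-reflexive ≃-refl

  +-mono-≲ : ∀ {x y z w} → x ≲ y → z ≲ w → x + z ≲ y + w
  +-mono-≲ {x} {y} {z} {w} ⌊ h ⌋ ⌊ h′ ⌋ = ⌊ (λ ε 0<ε → eventually-zip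
    (λ k p q → ≡.subst (seq x k ℚ.+ seq z k ℚ.≤_)
      (≡.trans (solve 3 (λ y w e → (y :+ e) :+ (w :+ e) := (y :+ w) :+ (e :+ e)) ≡.refl
                  (seq y k) (seq w k) (½ ℚ.* ε))
               (≡.cong (seq y k ℚ.+ seq w k ℚ.+_) (½+½ ε)))
      (ℚₚ.+-mono-≤ p q))
    (h (½ ℚ.* ε) (½-pos 0<ε)) (h′ (½ ℚ.* ε) (½-pos 0<ε))) ⌋

  +-cong : ∀ {x y z w} → x ≃ y → z ≃ w → x + z ≃ y + w
  +-cong h h′ = ≲-antisym (+-mono-≲ (≲-reflexive h) (≲-reflexive h′))
    (+-mono-≲ (≲-reflexive (≃-sym h)) (≲-reflexive (≃-sym h′)))

  -‿cong : ∀ {x y} → x ≃ y → - x ≃ - y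
  -‿cong {x} {y} ⌊ h ⌋ = ⌊ (λ ε 0<ε → eventually-map
    (λ k → ≡.subst (ℚ._≤ ε) (≡.sym
      (≡.trans (≡.cong ℚ.∣_∣ (neg-diff (seq x k) (seq y k))) (ℚₚ.∣-p∣≡∣p∣ _)))) (h ε 0<ε)) ⌋

  -- From xz - yw = x(z - w) + w(x - y): only `x` and `w` have to be bounded, and η is chosen so
  -- that the two errors add up to ε.
  *-cong : ∀ {x y z w} → x ≃ y → z ≃ w → x * z ≃ y * w
  *-cong {x} {y} {z} {w} ⌊ h ⌋ ⌊ h′ ⌋ = ⌊ (λ ε 0<ε →
    let B , 0<B , b         = bounded (cauchy x)
        C , 0<C , c         = bounded (cauchy w)
        η , 0<η , Bη+Cη≡ε   = rescale B C ε 0<B 0<C 0<ε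
    in eventually-zip
      (λ k (p , p′) (q , q′) → ≡.subst (ℚ.∣ seq x k ℚ.* seq z k ℚ.- seq y k ℚ.* seq w k ∣ ℚ.≤_) Bη+Cη≡ε
        (product-bound (seq x k) (seq z k) (seq y k) (seq w k) B C η 0<B 0<C p p′ q q′))
      (eventually-zip (λ _ → _,_) b c)
      (eventually-zip (λ _ → _,_) (h η 0<η) (h′ η 0<η))) ⌋

  -- The maximum is nonexpansive for the sup norm, so `⊔-cauchy` can use ε itself for both
  -- sequences.
  ∣⊔-⊔∣≤ : ∀ a b c d {e} → ℚ.∣ a ℚ.- c ∣ ℚ.≤ e → ℚ.∣ b ℚ.- d ∣ ℚ.≤ e →
    ℚ.∣ (a ℚ.⊔ b) ℚ.- (c ℚ.⊔ d) ∣ ℚ.≤ e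
  ∣⊔-⊔∣≤ a b c d {e} h h′ = ≤+⇒∣-∣≤ (a ℚ.⊔ b) (c ℚ.⊔ d)
    (half a b c d h h′)
    (half c d a b (≡.subst (ℚ._≤ e) (∣-∣-comm a c) h) (≡.subst (ℚ._≤ e) (∣-∣-comm b d) h′))
    where
    half : ∀ a b c d → ℚ.∣ a ℚ.- c ∣ ℚ.≤ e → ℚ.∣ b ℚ.- d ∣ ℚ.≤ e →
      a ℚ.⊔ b ℚ.≤ (c ℚ.⊔ d) ℚ.+ e
    half a b c d h h′ = ℚₚ.⊔-lub {_} {a} {b}
      (ℚₚ.≤-trans (∣-∣≤⇒≤+ a c h) (ℚₚ.+-monoˡ-≤ e {c} (ℚₚ.p≤p⊔q c d)))
      (ℚₚ.≤-trans (∣-∣≤⇒≤+ b d h′) (ℚₚ.+-monoˡ-≤ e {d} (ℚₚ.p≤q⊔p c d)))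

  ⊔-cauchy : ∀ {s t} → IsCauchy s → IsCauchy t → IsCauchy (λ k → s k ℚ.⊔ t k)
  ⊔-cauchy {s} {t} cs ct ε 0<ε with cs ε 0<ε | ct ε 0<ε
  ... | M , p | N , q = M ℕ.⊔ N , λ j k h h′ → ∣⊔-⊔∣≤ (s j) (t j) (s k) (t k)
    (p j k (ℕₚ.m⊔n≤o⇒m≤o M N h) (ℕₚ.m⊔n≤o⇒m≤o M N h′))
    (q j k (ℕₚ.m⊔n≤o⇒n≤o M N h) (ℕₚ.m⊔n≤o⇒n≤o M N h′))

-- Binary maxima of reals.

infixl 6 _⊔_

opaque

  -- The larger of two reals cannot be selected, as their order is not decidable; maxima of rational
  -- terms need no such decision.
  _⊔_ : ℝ → ℝ → ℝ
  x ⊔ y = mkℝ (λ k → seq x k ℚ.⊔ seq y k) (⊔-cauchy {seq x} {seq y} (cauchy x) (cauchy y))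

  seq-⊔ : ∀ x y k → seq (x ⊔ y) k ≡ seq x k ℚ.⊔ seq y k
  seq-⊔ x y k = ≡.refl

  x≲x⊔y : ∀ x y → x ≲ x ⊔ y
  x≲x⊔y x y = pointwise-≲ λ k → ℚₚ.p≤p⊔q (seq x k) (seq y k)

  y≲x⊔y : ∀ x y → y ≲ x ⊔ y
  y≲x⊔y x y = pointwise-≲ λ k → ℚₚ.p≤q⊔p (seq x k) (seq y k)

  ⊔-lub : ∀ {x y z} → x ≲ z → y ≲ z → x ⊔ y ≲ z
  ⊔-lub {x} {y} ⌊ h ⌋ ⌊ h′ ⌋ = ⌊ (λ ε 0<ε → eventually-zip
    (λ k → ℚₚ.⊔-lub {_} {seq x k} {seq y k}) (h ε 0<ε) (h′ ε 0<ε)) ⌋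

opaque

  x≲y⇒x⊔y≃y : ∀ {x y} → x ≲ y → x ⊔ y ≃ y
  x≲y⇒x⊔y≃y {x} {y} h = ≲-antisym (⊔-lub h ≲-refl) (y≲x⊔y x y)

-- The reals as a partially ordered commutative ring.

ℝ-commutativeRing : CommutativeRing 0ℓ 0ℓ
ℝ-commutativeRing = record
  { Carrier = ℝ ; _≈_ = _≃_ ; _+_ = _+_ ; _*_ = _*_ ; -_ = -_ ; 0# = 0ℝ ; 1# = 1ℝ
  ; isCommutativeRing = record
    { isRing = record
      { +-isAbelianGroup = record
        { isGroup = record
          { isMonoid = record
            { isSemigroup = record
              { isMagma = record
                { isEquivalence = record { refl = ≃-refl ; sym = ≃-sym ; trans = ≃-trans }
                ; ∙-cong = +-cong }
              ; assoc = λ x y z → pointwise-≃ λ k → ℚₚ.+-assoc (seq x k) (seq y k) (seq z k) }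
            ; identity = (λ x → pointwise-≃ λ k → ℚₚ.+-identityˡ (seq x k))
                       , (λ x → pointwise-≃ λ k → ℚₚ.+-identityʳ (seq x k)) }
          ; inverse = (λ x → pointwise-≃ λ k → ℚₚ.+-inverseˡ (seq x k))
                    , (λ x → pointwise-≃ λ k → ℚₚ.+-inverseʳ (seq x k))
          ; ⁻¹-cong = -‿cong }
        ; comm = λ x y → pointwise-≃ λ k → ℚₚ.+-comm (seq x k) (seq y k) }
      ; *-cong = *-cong
      ; *-assoc = λ x y z → pointwise-≃ λ k → ℚₚ.*-assoc (seq x k) (seq y k) (seq z k)
      ; *-identity = (λ x → pointwise-≃ λ k → ℚₚ.*-identityˡ (seq x k))
                   , (λ x → pointwise-≃ λ k → ℚₚ.*-identityʳ (seq x k))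
      ; distrib = (λ x y z → pointwise-≃ λ k → ℚₚ.*-distribˡ-+ (seq x k) (seq y k) (seq z k))
                , (λ x y z → pointwise-≃ λ k → ℚₚ.*-distribʳ-+ (seq x k) (seq y k) (seq z k)) }
    ; *-comm = λ x y → pointwise-≃ λ k → ℚₚ.*-comm (seq x k) (seq y k) } }

ℝ-poset : Poset 0ℓ 0ℓ 0ℓ
ℝ-poset = record
  { Carrier = ℝ ; _≈_ = _≃_ ; _≤_ = _≲_
  ; isPartialOrder = record
    { isPreorder = record
      { isEquivalence = CommutativeRing.isEquivalence ℝ-commutativeRing
      ; reflexive = ≲-reflexive
      ; trans = ≲-trans }
    ; antisym = ≲-antisym } }

open import Algebra.Properties.Semiring.Sum (CommutativeRing.semiring ℝ-commutativeRing)
  using (sum-cong-≋; ∑-distrib-+; ∑-comm; *-distribˡ-sum)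
open import Relation.Binary.Reasoning.PartialOrder ℝ-poset

opaque

  ∑-mono : ∀ {m} {f g : Fin m → ℝ} → (∀ k → f k ≲ g k) → ∑ f ≲ ∑ g
  ∑-mono {ℕ.zero}  h = ≲-refl
  ∑-mono {ℕ.suc m} h = +-mono-≲ (h zero) (∑-mono λ k → h (suc k))

  -- A nonnegative real may still have negative terms. `0ℝ ⊔ x` is an equal real whose terms are
  -- nonnegative, and for such representatives the claim holds termwise.
  *-nonneg : ∀ {x y} → 0ℝ ≲ x → 0ℝ ≲ y → 0ℝ ≲ x * y
  *-nonneg {x} {y} 0≤x 0≤y = begin
    0ℝ                    ≤⟨ pointwise-≲ {0ℝ} {(0ℝ ⊔ x) * (0ℝ ⊔ y)} (λ k →
                               0≤* (seq (0ℝ ⊔ x) k) (seq (0ℝ ⊔ y) k) (0≤0⊔ x k) (0≤0⊔ y k)) ⟩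
    (0ℝ ⊔ x) * (0ℝ ⊔ y)   ≈⟨ *-cong {0ℝ ⊔ x} {x} {0ℝ ⊔ y} {y} (x≲y⇒x⊔y≃y 0≤x) (x≲y⇒x⊔y≃y 0≤y) ⟩
    x * y                 ∎
    where
    0≤0⊔ : ∀ x k → 0ℚ ℚ.≤ seq (0ℝ ⊔ x) k
    0≤0⊔ x k = ≡.subst (0ℚ ℚ.≤_) (≡.sym (seq-⊔ 0ℝ x k)) (ℚₚ.p≤p⊔q 0ℚ (seq x k))

    0≤* : ∀ p q → 0ℚ ℚ.≤ p → 0ℚ ℚ.≤ q → 0ℚ ℚ.≤ p ℚ.* q
    0≤* p q 0≤p 0≤q = ℚₚ.nonNegative⁻¹ (p ℚ.* q)
      {{ℚₚ.nonNeg*nonNeg⇒nonNeg p {{ℚ.nonNegative {p} 0≤p}} q {{ℚ.nonNegative {q} 0≤q}}}}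

  -- Carries the linear reasoning: hypotheses are added up to one inequality, and a ring identity on
  -- the rational terms shows that the goal has the same difference of sides.
  ≲-shift : ∀ {x y z w} → x ≲ y → (∀ k → seq y k ℚ.- seq x k ≡ seq w k ℚ.- seq z k) → z ≲ w
  ≲-shift {x} {y} {z} {w} h eq = begin
    z             ≈⟨ pointwise-≃ (λ k → solve 2 (λ x z → z := x :+ (z :- x)) ≡.refl (seq x k) (seq z k)) ⟩
    x + (z - x)   ≤⟨ +-mono-≲ h ≲-refl ⟩
    y + (z - x)   ≈⟨ pointwise-≃ (λ k → ≡.trans
                       (solve 3 (λ x y z → y :+ (z :- x) := (y :- x) :+ z) ≡.refl (seq x k) (seq y k) (seq z k))
                       (≡.trans (≡.cong (ℚ._+ seq z k) (eq k))
                       (solve 2 (λ z w → (w :- z) :+ z := w) ≡.refl (seq z k) (seq w k)))) ⟩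
    w             ∎

  *-monoˡ-≲ : ∀ {c x y} → 0ℝ ≲ c → x ≲ y → c * x ≲ c * y
  *-monoˡ-≲ {c} {x} {y} 0≤c x≤y = ≲-shift
    (*-nonneg 0≤c (≲-shift {w = y - x} x≤y λ k →
      solve 2 (λ x y → y :- x := (y :- x) :- con 0ℚ) ≡.refl (seq x k) (seq y k)))
    λ k → solve 3 (λ c x y → c :* (y :- x) :- con 0ℚ := c :* y :- c :* x) ≡.refl (seq c k) (seq x k) (seq y k)

  -- If 0 < b ≤ s then |1/s(j) − 1/s(k)| ≤ |s(k) − s(j)| / b².
  reciprocal-cauchy : ∀ {s r : ℕ → ℚ} {b} → IsCauchy s → 0ℚ ℚ.< b → (∀ k → b ℚ.≤ s k) →
    (∀ k → 0ℚ ℚ.≤ r k) → (∀ k → s k ℚ.* r k ≡ 1ℚ) → IsCauchy r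
  reciprocal-cauchy {s} {r} {b} cs 0<b b≤s 0≤r sr≡1 ε 0<ε =
    let η = (b ℚ.* b) ℚ.* ε
        N , p = cs η (ℚₚ.positive⁻¹ η
          {{ℚₚ.pos*pos⇒pos (b ℚ.* b) {{ℚₚ.pos*pos⇒pos b b}} ε {{ℚ.positive {ε} 0<ε}}}})
    in N , λ j k h h′ → Q.begin
      ℚ.∣ r j ℚ.- r k ∣
        Q.≡⟨ ≡.cong ℚ.∣_∣ (≡.trans (≡.cong₂ ℚ._-_
              (≡.trans (≡.sym (ℚₚ.*-identityʳ (r j))) (≡.cong (r j ℚ.*_) (≡.sym (sr≡1 k))))
              (≡.trans (≡.sym (ℚₚ.*-identityʳ (r k))) (≡.cong (r k ℚ.*_) (≡.sym (sr≡1 j)))))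
              (solve 4 (λ u v x y → u :* (y :* v) :- v :* (x :* u) := (u :* v) :* (y :- x)) ≡.refl
                (r j) (r k) (s j) (s k))) ⟩
      ℚ.∣ (r j ℚ.* r k) ℚ.* (s k ℚ.- s j) ∣
        Q.≡⟨ ℚₚ.∣p*q∣≡∣p∣*∣q∣ (r j ℚ.* r k) (s k ℚ.- s j) ⟩
      ℚ.∣ r j ℚ.* r k ∣ ℚ.* ℚ.∣ s k ℚ.- s j ∣
        Q.≡⟨ ≡.cong (ℚ._* ℚ.∣ s k ℚ.- s j ∣) (ℚₚ.0≤p⇒∣p∣≡p (ℚₚ.nonNegative⁻¹ (r j ℚ.* r k) {{rr≥0 j k}})) ⟩
      (r j ℚ.* r k) ℚ.* ℚ.∣ s k ℚ.- s j ∣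
        Q.≤⟨ ℚₚ.*-monoˡ-≤-nonNeg (r j ℚ.* r k) {{rr≥0 j k}} (p k j h′ h) ⟩
      (r j ℚ.* r k) ℚ.* ((b ℚ.* b) ℚ.* ε)
        Q.≡⟨ solve 4 (λ u v b e → (u :* v) :* ((b :* b) :* e) := (b :* u) :* ((b :* v) :* e)) ≡.refl
              (r j) (r k) b ε ⟩
      (b ℚ.* r j) ℚ.* ((b ℚ.* r k) ℚ.* ε)
        Q.≤⟨ br*≤ j ((b ℚ.* r k) ℚ.* ε) {{ℚₚ.nonNeg*nonNeg⇒nonNeg (b ℚ.* r k)
              {{ℚₚ.nonNeg*nonNeg⇒nonNeg b {{b≥0}} (r k) {{r≥0 k}}}} ε {{ε≥0}}}} ⟩
      (b ℚ.* r k) ℚ.* ε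
        Q.≤⟨ br*≤ k ε {{ε≥0}} ⟩
      ε Q.∎
    where
    module Q = ℚₚ.≤-Reasoning

    instance
      b>0 : ℚ.Positive b
      b>0 = ℚ.positive {b} 0<b

    b≥0 : ℚ.NonNegative b
    b≥0 = ℚₚ.pos⇒nonNeg b

    ε≥0 : ℚ.NonNegative ε
    ε≥0 = ℚ.nonNegative {ε} (ℚₚ.<⇒≤ 0<ε)

    r≥0 : ∀ k → ℚ.NonNegative (r k)
    r≥0 k = ℚ.nonNegative {r k} (0≤r k)

    rr≥0 : ∀ j k → ℚ.NonNegative (r j ℚ.* r k)
    rr≥0 j k = ℚₚ.nonNeg*nonNeg⇒nonNeg (r j) {{r≥0 j}} (r k) {{r≥0 k}}

    br*≤ : ∀ j v → {{ℚ.NonNegative v}} → (b ℚ.* r j) ℚ.* v ℚ.≤ v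
    br*≤ j v = ≡.subst ((b ℚ.* r j) ℚ.* v ℚ.≤_) (≡.trans (≡.cong (ℚ._* v) (sr≡1 j)) (ℚₚ.*-identityˡ v))
      (ℚₚ.*-monoʳ-≤-nonNeg v (ℚₚ.*-monoʳ-≤-nonNeg (r j) {{r≥0 j}} (b≤s j)))

  inverse : ∀ {x} → 0ℝ < x → ∃[ y ] (0ℝ ≲ y) × (x * y ≃ 1ℝ)
  inverse {x} (b , 0<b , N , b≤x) =
    mkℝ r (reciprocal-cauchy {s} {r} (⊔-cauchy {λ _ → b} {seq x} (const-cauchy b) (cauchy x)) 0<b
      (λ k → ℚₚ.p≤p⊔q b (seq x k)) 0≤r sr≡1)
    , pointwise-≲ 0≤r
    , ⌊ (λ ε 0<ε → N , λ k h → ≡.subst (λ q → ℚ.∣ q ℚ.- 1ℚ ∣ ℚ.≤ ε)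
          (≡.trans (≡.sym (sr≡1 k)) (≡.cong (ℚ._* r k) (ℚₚ.p≤q⇒p⊔q≡q
            (≡.subst (ℚ._≤ seq x k) (ℚₚ.+-identityˡ b) (b≤x k h)))))
          (ℚₚ.<⇒≤ 0<ε)) ⌋
    where
    s r : ℕ → ℚ
    -- Finitely many terms of `x` may be zero or negative. The cutoff at `b` makes every term
    -- invertible and changes none from `N` on, where `b` is already a lower bound.
    s k = b ℚ.⊔ seq x k

    s-inverse : ∀ k → ∃[ i ] (0ℚ ℚ.< i) × (s k ℚ.* i ≡ 1ℚ)
    s-inverse k = reciprocal (s k) (ℚₚ.<-≤-trans 0<b (ℚₚ.p≤p⊔q b (seq x k)))

    r k = proj₁ (s-inverse k)

    0≤r : ∀ k → 0ℚ ℚ.≤ r k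
    0≤r k = ℚₚ.<⇒≤ (proj₁ (proj₂ (s-inverse k)))

    sr≡1 : ∀ k → s k ℚ.* r k ≡ 1ℚ
    sr≡1 k = proj₂ (proj₂ (s-inverse k))

  <⇒≲ : ∀ {x y} → x < y → x ≲ y
  <⇒≲ {x} {y} (b , 0<b , N , h) = ⌊ (λ ε 0<ε → N , λ k N≤k → Q.begin
    seq x k           Q.≡⟨ ≡.sym (ℚₚ.+-identityʳ (seq x k)) ⟩
    seq x k ℚ.+ 0ℚ    Q.≤⟨ ℚₚ.+-monoʳ-≤ (seq x k) (ℚₚ.<⇒≤ 0<b) ⟩
    seq x k ℚ.+ b     Q.≤⟨ h k N≤k ⟩
    seq y k           Q.≡⟨ ≡.sym (ℚₚ.+-identityʳ (seq y k)) ⟩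
    seq y k ℚ.+ 0ℚ    Q.≤⟨ ℚₚ.+-monoʳ-≤ (seq y k) (ℚₚ.<⇒≤ 0<ε) ⟩
    seq y k ℚ.+ ε     Q.∎) ⌋
    where module Q = ℚₚ.≤-Reasoning

-- Which `f i` is largest stays undecided, so `least` is the way to bound the value from above. The
-- base `b` gives a value even to an empty selection.
record Supremum {p} (P : Fin p → Bool) (b : ℝ) (f : Fin p → ℝ) : Set where
  field
    value : ℝ
    base  : b ≲ value
    upper : ∀ i → P i ≡ true → f i ≲ value
    least : ∀ {u} → b ≲ u → (∀ i → P i ≡ true → f i ≲ u) → value ≲ u

opaque

  supremum : ∀ {p} (P : Fin p → Bool) (b : ℝ) (f : Fin p → ℝ) → Supremum P b f
  supremum {ℕ.zero}  P b f = record
    { value = b ; base = ≲-refl ; upper = λ () ; least = λ b≤u _ → b≤u }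
  supremum {ℕ.suc p} P b f with supremum (λ i → P (suc i)) b (λ i → f (suc i)) | P zero in eq
  ... | s | true = record
    { value = f zero ⊔ value
    ; base  = ≲-trans base (y≲x⊔y (f zero) value)
    ; upper = λ { zero _ → x≲x⊔y (f zero) value ; (suc i) h → ≲-trans (upper i h) (y≲x⊔y (f zero) value) }
    ; least = λ b≤u f≤u → ⊔-lub (f≤u zero eq) (least b≤u λ i → f≤u (suc i)) }
    where open Supremum s
  ... | s | false = record
    { value = value
    ; base  = base
    ; upper = λ { zero h → contradiction (≡.trans (≡.sym h) eq) (λ ()) ; (suc i) h → upper i h }
    ; least = λ b≤u f≤u → least b≤u λ i → f≤u (suc i) }
    where open Supremum s

-- Cardinalities as rationals, and finite sums.

ι : ℕ → ℚ
ι k = + k ℚ./ 1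

opaque

  -- `ℚ._/_` reduces to lowest terms. Nothing is cancelled in unnormalised fractions, so there
  -- identities become cross-multiplications of integers.
  toℚᵘ-/ : ∀ k n .{{_ : ℕ.NonZero n}} → ℚ.toℚᵘ (+ k ℚ./ n) ℚᵘ.≃ + k ℚᵘ./ n
  toℚᵘ-/ k (ℕ.suc n) = ℚₚ.toℚᵘ-fromℚᵘ (ℚᵘ.mkℚᵘ (+ k) n)

  ι-+ : ∀ j k → ι (j ℕ.+ k) ≡ ι j ℚ.+ ι k
  ι-+ j k = ℚₚ.toℚᵘ-injective (ℚᵘₚ.≃-trans (toℚᵘ-/ (j ℕ.+ k) 1) (ℚᵘₚ.≃-trans
    (ℚᵘ.*≡* (≡.cong (ℤ._* + 1) (≡.trans (≡.cong₂ ℤ._+_ (≡.sym (ℤₚ.*-identityʳ (+ j))) (≡.sym (ℤₚ.*-identityʳ (+ k)))) ≡.refl)))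
    (ℚᵘₚ.≃-sym (ℚᵘₚ.≃-trans (ℚₚ.toℚᵘ-homo-+ (ι j) (ι k)) (ℚᵘₚ.+-cong (toℚᵘ-/ j 1) (toℚᵘ-/ k 1))))))

  /-*-ι : ∀ k n .{{_ : ℕ.NonZero n}} → (+ k ℚ./ n) ℚ.* ι n ≡ ι k
  /-*-ι k n@(ℕ.suc _) = ℚₚ.toℚᵘ-injective (ℚᵘₚ.≃-trans (ℚₚ.toℚᵘ-homo-* (+ k ℚ./ n) (ι n))
    (ℚᵘₚ.≃-trans (ℚᵘₚ.*-cong (toℚᵘ-/ k n) (toℚᵘ-/ n 1)) (ℚᵘₚ.≃-trans
      (ℚᵘ.*≡* (≡.trans (ℤₚ.*-identityʳ (+ k ℤ.* + n)) (≡.cong (λ m → + k ℤ.* + m) (≡.sym (ℕₚ.*-identityʳ n)))))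
      (ℚᵘₚ.≃-sym (toℚᵘ-/ k 1)))))

  -- The inserted factor 1 = (1/n) · n clears both denominators, so no sum of reduced fractions has
  -- to be computed.
  /-+-/ : ∀ {j k n} .{{_ : ℕ.NonZero n}} → j ℕ.+ k ≡ n → (+ j ℚ./ n) ℚ.+ (+ k ℚ./ n) ≡ 1ℚ
  /-+-/ {j} {k} {n} eq = ≡-Q.begin
    p ℚ.+ q                         ≡-Q.≡⟨ ≡.sym (ℚₚ.*-identityʳ (p ℚ.+ q)) ⟩
    (p ℚ.+ q) ℚ.* 1ℚ                ≡-Q.≡⟨ ≡.cong ((p ℚ.+ q) ℚ.*_) (≡.sym (/-*-ι 1 n)) ⟩
    (p ℚ.+ q) ℚ.* (r ℚ.* ι n)       ≡-Q.≡⟨ solve 4 (λ p q r n → (p :+ q) :* (r :* n) := r :* (p :* n :+ q :* n))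
                                        ≡.refl p q r (ι n) ⟩
    r ℚ.* (p ℚ.* ι n ℚ.+ q ℚ.* ι n) ≡-Q.≡⟨ ≡.cong (r ℚ.*_) (≡.cong₂ ℚ._+_ (/-*-ι j n) (/-*-ι k n)) ⟩
    r ℚ.* (ι j ℚ.+ ι k)             ≡-Q.≡⟨ ≡.cong (r ℚ.*_) (≡.trans (≡.sym (ι-+ j k)) (≡.cong ι eq)) ⟩
    r ℚ.* ι n                       ≡-Q.≡⟨ /-*-ι 1 n ⟩
    1ℚ                              ≡-Q.∎
    where
    module ≡-Q = ≡.≡-Reasoning

    p q r : ℚ
    p = + j ℚ./ n
    q = + k ℚ./ n
    r = + 1 ℚ./ n

  ∑-const : ∀ n c → ∑ {n} (λ _ → c) ≃ fromℚ (ι n) * c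
  ∑-const ℕ.zero    c = pointwise-≃ λ k → ≡.sym (ℚₚ.*-zeroˡ (seq c k))
  ∑-const (ℕ.suc n) c = begin-equality
    c + ∑ {n} (λ _ → c)             ≈⟨ +-cong (≃-refl {c}) (∑-const n c) ⟩
    c + fromℚ (ι n) * c             ≈⟨ pointwise-≃ (λ k → ≡.trans
      (solve 2 (λ c n → c :+ n :* c := (con 1ℚ :+ n) :* c) ≡.refl (seq c k) (ι n))
      (≡.cong (ℚ._* seq c k) (≡.sym (ι-+ 1 n)))) ⟩
    fromℚ (ι (ℕ.suc n)) * c         ∎

  ∑-𝟙 : ∀ {n} (C : Subset n) → ∑ (𝟙 C) ≃ fromℚ (ι ∣ C ∣)
  ∑-𝟙 []            = pointwise-≃ λ k → ≡.refl
  ∑-𝟙 (inside ∷ C)  = begin-equality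
    1ℝ + ∑ (𝟙 C)                    ≈⟨ +-cong (≃-refl {1ℝ}) (∑-𝟙 C) ⟩
    1ℝ + fromℚ (ι ∣ C ∣)            ≈⟨ pointwise-≃ (λ k → ≡.sym (ι-+ 1 ∣ C ∣)) ⟩
    fromℚ (ι ∣ inside ∷ C ∣)        ∎
  ∑-𝟙 (outside ∷ C) = begin-equality
    0ℝ + ∑ (𝟙 C)                    ≈⟨ pointwise-≃ (λ k → ℚₚ.+-identityˡ (seq (∑ (𝟙 C)) k)) ⟩
    ∑ (𝟙 C)                         ≈⟨ ∑-𝟙 C ⟩
    fromℚ (ι ∣ C ∣)                 ∎

  ∑-- : ∀ {m} (f g : Fin m → ℝ) → ∑ (λ k → f k - g k) ≃ ∑ f - ∑ g
  ∑-- {ℕ.zero}  f g = pointwise-≃ λ k → ≡.refl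
  ∑-- {ℕ.suc m} f g = begin-equality
    (f zero - g zero) + ∑ (λ k → f (suc k) - g (suc k))
      ≈⟨ +-cong (≃-refl {f zero - g zero}) (∑-- (λ k → f (suc k)) (λ k → g (suc k))) ⟩
    (f zero - g zero) + (∑ (λ k → f (suc k)) - ∑ (λ k → g (suc k)))
      ≈⟨ pointwise-≃ (λ k → solve 4 (λ a b c d → (a :- b) :+ (c :- d) := (a :+ c) :- (b :+ d)) ≡.refl
           (seq (f zero) k) (seq (g zero) k) (seq (∑ (λ k → f (suc k))) k) (seq (∑ (λ k → g (suc k))) k)) ⟩
    ∑ f - ∑ g ∎

-- Splits

bit : Bool → ℝ
bit p = if p then 1ℝ else 0ℝ

-- The cut metric on two points. `δ σ` is its pullback along `side σ`, which turns statements about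
-- splits into Boolean case checks.
separation : Bool → Bool → ℝ
separation p q = bit (p xor q)

opaque

  separation-triangle : ∀ p q r → separation p r ≲ separation p q + separation q r
  separation-triangle true  true  r     = pointwise-≲ λ k → ℚₚ.≤-reflexive (≡.sym (ℚₚ.+-identityˡ _))
  separation-triangle true  false true  = pointwise-≲ λ k → ℚₚ.nonNegative⁻¹ (1ℚ ℚ.+ 1ℚ)
  separation-triangle true  false false = pointwise-≲ λ k → ℚₚ.≤-refl
  separation-triangle false false r     = pointwise-≲ λ k → ℚₚ.≤-reflexive (≡.sym (ℚₚ.+-identityˡ _))
  separation-triangle false true  false = pointwise-≲ λ k → ℚₚ.nonNegative⁻¹ (1ℚ ℚ.+ 1ℚ)
  separation-triangle false true  true  = pointwise-≲ λ k → ℚₚ.≤-refl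

  separation-refl : ∀ p → separation p p ≡ 0ℝ
  separation-refl true  = ≡.refl
  separation-refl false = ≡.refl

  -- The coinciding pair contributes 0 on the left; the remaining distance is bounded by the
  -- triangle inequality through the common point.
  separation-quartet : ∀ p p′ q q′ → p ≡ p′ ⊎ q ≡ q′ →
    separation p p′ + separation q′ q ≲ separation p q + separation q′ p′
  separation-quartet p .p q q′ (inj₁ ≡.refl) = begin
    separation p p + separation q′ q
      ≈⟨ pointwise-≃ (λ k → ≡.trans (≡.cong (λ x → seq x k ℚ.+ seq (separation q′ q) k) (separation-refl p))
                                    (ℚₚ.+-identityˡ _)) ⟩
    separation q′ q
      ≤⟨ separation-triangle q′ p q ⟩
    separation q′ p + separation p q
      ≈⟨ pointwise-≃ (λ k → ℚₚ.+-comm (seq (separation q′ p) k) (seq (separation p q) k)) ⟩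
    separation p q + separation q′ p ∎
  separation-quartet p p′ q .q (inj₂ ≡.refl) = begin
    separation p p′ + separation q q
      ≈⟨ pointwise-≃ (λ k → ≡.trans (≡.cong (λ x → seq (separation p p′) k ℚ.+ seq x k) (separation-refl q))
                                    (ℚₚ.+-identityʳ _)) ⟩
    separation p p′
      ≤⟨ separation-triangle p q p′ ⟩
    separation p q + separation q p′ ∎

  does⇒∈ : ∀ {n} i (C : Subset n) → does (i ∈? C) ≡ true → i ∈ C
  does⇒∈ i C eq with i ∈? C
  ... | yes i∈C = i∈C

  empty-∩ : ∀ {n} i (C D : Subset n) → Empty (C ∩ D) → i ∈ C → does (i ∈? D) ≡ false
  empty-∩ i C D empty i∈C with i ∈? D
  ... | yes i∈D = ⊥-elim (empty (i , x∈p∩q⁺ (i∈C , i∈D)))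
  ... | no  _   = ≡.refl

module _ {n} (σ : Split n) where

  open Split σ

  side : Fin n → Bool
  side i = does (i ∈? A)

  instance
    n-nonZero : ℕ.NonZero n
    n-nonZero = nonZeroIndex (proj₁ A-nonempty)

  -- The mean of the coordinates of `𝟙 A`; subtracting it makes the coordinate sum vanish.
  centre : ℝ
  centre = fromℚ (+ ∣ A ∣ ℚ./ n)

  opaque

    -- The segment S⟨ σ ⟩ joins this vector to its negative.
    direction : ℝ^ n
    direction i = bit (side i) - centre

  opaque

    B≡∁A : B ≡ ∁ A
    B≡∁A = ⊆-antisym
      (λ i∈B → x∉p⇒x∈∁p λ i∈A → disjoint (_ , x∈p∩q⁺ (i∈A , i∈B)))
      (λ {i} i∈∁A → case-∪ i∈∁A (x∈p∪q⁻ A B (≡.subst (i ∈_) (≡.sym cover) ∈⊤)))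
      where
      case-∪ : ∀ {i} → i ∈ ∁ A → i ∈ A ⊎ i ∈ B → i ∈ B
      case-∪ i∈∁A (inj₁ i∈A) = ⊥-elim (x∈∁p⇒x∉p i∈∁A i∈A)
      case-∪ i∈∁A (inj₂ i∈B) = i∈B

    does-B : ∀ i → does (i ∈? B) ≡ not (side i)
    does-B i rewrite B≡∁A with i ∈? A | i ∈? ∁ A
    ... | yes i∈A | yes i∈∁A = ⊥-elim (x∈∁p⇒x∉p i∈∁A i∈A)
    ... | yes i∈A | no  _    = ≡.refl
    ... | no  _   | yes _    = ≡.refl
    ... | no  i∉A | no  i∉∁A = ⊥-elim (i∉∁A (x∉p⇒x∈∁p i∉A))

    side-false⇒∈B : ∀ i → side i ≡ false → i ∈ B
    side-false⇒∈B i eq = does⇒∈ i B (≡.trans (does-B i) (≡.cong not eq))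

    ∣A∣/n+∣B∣/n : (+ ∣ A ∣ ℚ./ n) ℚ.+ (+ ∣ B ∣ ℚ./ n) ≡ 1ℚ
    ∣A∣/n+∣B∣/n = /-+-/ {∣ A ∣} {∣ B ∣} (≡.trans
      (≡.cong (∣ A ∣ ℕ.+_) (≡.trans (≡.cong ∣_∣ B≡∁A) (∣∁p∣≡n∸∣p∣ A))) (ℕₚ.m+[n∸m]≡n (∣p∣≤n A)))

    δ≡separation : ∀ i j → δ σ i j ≡ separation (side i) (side j)
    δ≡separation i j rewrite does-B i | does-B j with side i | side j
    ... | true  | true  = ≡.refl
    ... | true  | false = ≡.refl
    ... | false | true  = ≡.refl
    ... | false | false = ≡.refl

  opaque
    unfolding direction

    ∑-direction : ∑ direction ≃ 0ℝ
    ∑-direction = begin-equality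
      ∑ direction                                   ≈⟨ ∑-- (𝟙 A) (λ _ → centre) ⟩
      ∑ (𝟙 A) - ∑ {n} (λ _ → centre)                ≈⟨ +-cong (∑-𝟙 A) (-‿cong (∑-const n centre)) ⟩
      fromℚ (ι ∣ A ∣) - fromℚ (ι n) * centre        ≈⟨ pointwise-≃ (λ k → ≡.trans
        (≡.cong (λ q → ι ∣ A ∣ ℚ.- q) (≡.trans (ℚₚ.*-comm (ι n) _) (/-*-ι ∣ A ∣ n))) (ℚₚ.+-inverseʳ (ι ∣ A ∣))) ⟩
      0ℝ                                            ∎

    -- Since |A|/n + |B|/n = 1, the endpoint has the value |B|/n = 1 - |A|/n on A and -|A|/n on B,
    -- which is `𝟙 A` minus its mean.
    direction-endpoint : ∀ i k →
      (+ ∣ B ∣ ℚ./ n) ℚ.* seq (𝟙 A i) k ℚ.- (+ ∣ A ∣ ℚ./ n) ℚ.* seq (𝟙 B i) k ≡ seq (direction i) k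
    direction-endpoint i k rewrite does-B i with side i
    ... | true  = ≡.trans (solve 2 (λ a b → b :* con 1ℚ :- a :* con 0ℚ := (a :+ b) :- a) ≡.refl
                    (+ ∣ A ∣ ℚ./ n) (+ ∣ B ∣ ℚ./ n)) (≡.cong (ℚ._- (+ ∣ A ∣ ℚ./ n)) ∣A∣/n+∣B∣/n)
    ... | false = solve 2 (λ a b → b :* con 0ℚ :- a :* con 1ℚ := con 0ℚ :- a) ≡.refl
                    (+ ∣ A ∣ ℚ./ n) (+ ∣ B ∣ ℚ./ n)

    -- The mean cancels. Hence β enters the constraint of a pair only with the factor 1, -1 or 0,
    -- according to the sides.
    direction-diff : ∀ i j c → c * direction i - c * direction j ≃ c * (bit (side i) - bit (side j))
    direction-diff i j c = pointwise-≃ λ k → solve 4 (λ c p q m → c :* (p :- m) :- c :* (q :- m) := c :* (p :- q))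
      ≡.refl (seq c k) (seq (bit (side i)) k) (seq (bit (side j)) k) (seq centre k)

-- The segment of a split as the multiples of one vector.

module _ {n} (σ : Split n) where

  open Split σ

  endpoint⁺ endpoint⁻ : ℝ^ n
  endpoint⁺ = fromℚ ((+ ∣ B ∣ ℚ./ n) {{n-nonZero σ}}) · 𝟙 A ⊖ fromℚ ((+ ∣ A ∣ ℚ./ n) {{n-nonZero σ}}) · 𝟙 B
  endpoint⁻ = fromℚ ((+ ∣ A ∣ ℚ./ n) {{n-nonZero σ}}) · 𝟙 B ⊖ fromℚ ((+ ∣ B ∣ ℚ./ n) {{n-nonZero σ}}) · 𝟙 A

  opaque

    -- The second endpoint is the negative of the first, so only the difference of the coefficients
    -- survives.
    combination : ∀ (c : Fin 2 → ℝ) i → ∑ᵛ (λ k → c k · (endpoint⁺ VF.∷ endpoint⁻ VF.∷ VF.[]) k) i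
      ≃ (c zero - c (suc zero)) * direction σ i
    combination c i = pointwise-≃ λ k → ≡.trans
      (solve 4 (λ c c′ p q → c :* (p :- q) :+ (c′ :* (q :- p) :+ con 0ℚ) := (c :- c′) :* (p :- q)) ≡.refl
        (seq (c zero) k) (seq (c (suc zero)) k)
        (p ℚ.* seq (𝟙 A i) k) (q ℚ.* seq (𝟙 B i) k))
      (≡.cong ((seq (c zero) k ℚ.- seq (c (suc zero)) k) ℚ.*_) (direction-endpoint σ i k))
      where
      p q : ℚ
      p = (+ ∣ B ∣ ℚ./ n) {{n-nonZero σ}}
      q = (+ ∣ A ∣ ℚ./ n) {{n-nonZero σ}}

    -- With c + c′ = 1 the value t = c - c′ satisfies t + 1 = 2c and 1 - t = 2c′; both are
    -- nonnegative, whence the doubled coefficients in the two bounds.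
    S⇒direction : ∀ {y} → S⟨ σ ⟩ y →
      ∃[ t ] (- 1ℝ ≲ t) × (t ≲ 1ℝ) × (∀ i → y i ≃ t * direction σ i)
    S⇒direction {y} (c , c≥0 , ∑c≈1 , y≋) = c zero - c (suc zero)
      , ≲-shift (+-mono-≲ (≲-reflexive ∑c≃1) (+-mono-≲ (0≲c zero) (0≲c zero))) (λ k →
          solve 2 (λ c c′ → (con 1ℚ :+ (c :+ c)) :- ((c :+ (c′ :+ con 0ℚ)) :+ (con 0ℚ :+ con 0ℚ))
            := (c :- c′) :- (:- con 1ℚ)) ≡.refl (seq (c zero) k) (seq (c (suc zero)) k))
      , ≲-shift (+-mono-≲ (≲-reflexive ∑c≃1) (+-mono-≲ (0≲c (suc zero)) (0≲c (suc zero)))) (λ k →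
          solve 2 (λ c c′ → (con 1ℚ :+ (c′ :+ c′)) :- ((c :+ (c′ :+ con 0ℚ)) :+ (con 0ℚ :+ con 0ℚ))
            := con 1ℚ :- (c :- c′)) ≡.refl (seq (c zero) k) (seq (c (suc zero)) k))
      , λ i → ≃-trans {y i} ⌊ y≋ i ⌋ (combination c i)
      where
      0≲c : ∀ k → 0ℝ ≲ c k
      0≲c k = ⌊ c≥0 k ⌋

      ∑c≃1 : ∑ c ≃ 1ℝ
      ∑c≃1 = ⌊ ∑c≈1 ⌋

    direction⇒S : ∀ {t} → - 1ℝ ≲ t → t ≲ 1ℝ → S⟨ σ ⟩ (t · direction σ)
    direction⇒S {t} -1≤t t≤1 = c , c≥0 , un≈ ∑c≃1 , λ i → un≈ (begin-equality
      t * direction σ i                              ≈⟨ pointwise-≃ (λ k →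
        solve 2 (λ t u → t :* u := (con ½ :* (con 1ℚ :+ t) :- con ½ :* (con 1ℚ :- t)) :* u) ≡.refl
          (seq t k) (seq (direction σ i) k)) ⟩
      (c zero - c (suc zero)) * direction σ i        ≈⟨ ≃-sym (combination c i) ⟩
      ∑ᵛ (λ k → c k · (endpoint⁺ VF.∷ endpoint⁻ VF.∷ VF.[]) k) i ∎)
      where
      c : Fin 2 → ℝ
      -- The solution of c - c′ = t, c + c′ = 1.
      c zero    = fromℚ ½ * (1ℝ + t)
      c (suc _) = fromℚ ½ * (1ℝ - t)

      0≤½ : 0ℝ ≲ fromℚ ½
      0≤½ = pointwise-≲ λ k → ℚₚ.nonNegative⁻¹ ½

      c≥0 : ∀ k → 0ℝ ≤ c k
      c≥0 zero    = un≤ (*-nonneg 0≤½ (≲-shift {w = 1ℝ + t} -1≤t λ k →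
        solve 1 (λ t → t :- (:- con 1ℚ) := (con 1ℚ :+ t) :- con 0ℚ) ≡.refl (seq t k)))
      c≥0 (suc _) = un≤ (*-nonneg 0≤½ (≲-shift {w = 1ℝ - t} t≤1 λ k →
        solve 1 (λ t → con 1ℚ :- t := (con 1ℚ :- t) :- con 0ℚ) ≡.refl (seq t k)))

      ∑c≃1 : ∑ c ≃ 1ℝ
      ∑c≃1 = pointwise-≃ λ k → solve 1 (λ t →
        con ½ :* (con 1ℚ :+ t) :+ (con ½ :* (con 1ℚ :- t) :+ con 0ℚ) := con 1ℚ) ≡.refl (seq t k)

    bit-diff : ∀ {t} → - 1ℝ ≲ t → t ≲ 1ℝ → ∀ p q → t * (bit p - bit q) ≲ separation p q
    bit-diff {t} _    _   true  true  = ≲-reflexive (pointwise-≃ λ k →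
      solve 1 (λ t → t :* (con 1ℚ :- con 1ℚ) := con 0ℚ) ≡.refl (seq t k))
    bit-diff {t} _    _   false false = ≲-reflexive (pointwise-≃ λ k →
      solve 1 (λ t → t :* (con 0ℚ :- con 0ℚ) := con 0ℚ) ≡.refl (seq t k))
    bit-diff {t} _    t≤1 true  false = ≲-shift t≤1 λ k →
      solve 1 (λ t → con 1ℚ :- t := con 1ℚ :- t :* (con 1ℚ :- con 0ℚ)) ≡.refl (seq t k)
    bit-diff {t} -1≤t _   false true  = ≲-shift -1≤t λ k →
      solve 1 (λ t → t :- (:- con 1ℚ) := con 1ℚ :- t :* (con 0ℚ :- con 1ℚ)) ≡.refl (seq t k)

    ∑-multiple : ∀ t → ∑ (λ i → t * direction σ i) ≃ 0ℝ
    ∑-multiple t = begin-equality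
      ∑ (λ i → t * direction σ i)       ≈⟨ ≃-sym (*-distribˡ-sum t (direction σ)) ⟩
      t * ∑ (direction σ)               ≈⟨ *-cong {t} {t} {∑ (direction σ)} {0ℝ} ≃-refl (∑-direction σ) ⟩
      t * 0ℝ                            ≈⟨ pointwise-≃ (λ k → ℚₚ.*-zeroʳ (seq t k)) ⟩
      0ℝ                                ∎

    multiple-diff : ∀ {t} → - 1ℝ ≲ t → t ≲ 1ℝ → ∀ i j →
      t * direction σ i - t * direction σ j ≲ δ σ i j
    multiple-diff {t} -1≤t t≤1 i j = begin
      t * direction σ i - t * direction σ j      ≈⟨ direction-diff σ i j t ⟩
      t * (bit (side σ i) - bit (side σ j))      ≤⟨ bit-diff -1≤t t≤1 (side σ i) (side σ j) ⟩
      separation (side σ i) (side σ j)           ≡⟨ ≡.sym (δ≡separation σ i j) ⟩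
      δ σ i j                                    ∎

    S⊆LIP : ∀ {y} → S⟨ σ ⟩ y → LIP (δ σ) y
    S⊆LIP {y} y∈S =
      let t , -1≤t , t≤1 , y≃ = S⇒direction y∈S in
        un≈ (≃-trans {∑ y} (sum-cong-≋ {x = y} {y = λ i → t * direction σ i} y≃) (∑-multiple t))
      , λ i j → un≤ (≲-trans {y i - y j}
          (≲-reflexive (+-cong {y i} {t * direction σ i} { - y j} { - (t * direction σ j)}
            (y≃ i) (-‿cong {y j} {t * direction σ j} (y≃ j))))
          (multiple-diff -1≤t t≤1 i j))

-- Point sets

opaque

  ⋆-LIP : ∀ {n a} {P : PointSet n} {e} → 0ℝ ≲ a → P ⊆ LIP e → a ⋆ P ⊆ LIP (λ i j → a * e i j)
  ⋆-LIP {a = a} {e = e} 0≤a P⊆ {x} (y , y∈P , x≋) = un≈ (begin-equality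
      ∑ x                      ≈⟨ sum-cong-≋ {y = λ i → a * y i} (λ i → ⌊ x≋ i ⌋) ⟩
      ∑ (λ i → a * y i)        ≈⟨ ≃-sym (*-distribˡ-sum a y) ⟩
      a * ∑ y                  ≈⟨ *-cong (≃-refl {a}) ⌊ proj₁ (P⊆ y∈P) ⌋ ⟩
      a * 0ℝ                   ≈⟨ pointwise-≃ (λ k → ℚₚ.*-zeroʳ (seq a k)) ⟩
      0ℝ                       ∎)
    , λ i j → un≤ (begin
      x i - x j                ≈⟨ +-cong ⌊ x≋ i ⌋ (-‿cong ⌊ x≋ j ⌋) ⟩
      a * y i - a * y j        ≈⟨ pointwise-≃ (λ k →
        solve 3 (λ a y z → a :* y :- a :* z := a :* (y :- z)) ≡.refl (seq a k) (seq (y i) k) (seq (y j) k)) ⟩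
      a * (y i - y j)          ≤⟨ *-monoˡ-≲ {y = e i j} 0≤a ⌊ proj₂ (P⊆ y∈P) i j ⌋ ⟩
      a * e i j                ∎)

  -- Coordinate sums and coordinate differences are additive in the point, so the bounds of the
  -- summands add up.
  MinkowskiSum-LIP : ∀ {m n} {P : Fin m → PointSet n} {e : Fin m → Fin n → Fin n → ℝ} →
    (∀ k → P k ⊆ LIP (e k)) → MinkowskiSum P ⊆ LIP (λ i j → ∑ (λ k → e k i j))
  MinkowskiSum-LIP {m} {n} {e = e} P⊆ {x} (y , y∈P , x≋) = un≈ (begin-equality
      ∑ x                            ≈⟨ sum-cong-≋ {y = λ i → ∑ (λ k → y k i)} (λ i → ⌊ x≋ i ⌋) ⟩
      ∑ (λ i → ∑ (λ k → y k i))      ≈⟨ ∑-comm (λ i k → y k i) ⟩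
      ∑ (λ k → ∑ (y k))              ≈⟨ sum-cong-≋ {y = λ k → 0ℝ} (λ k → ⌊ proj₁ (P⊆ k (y∈P k)) ⌋) ⟩
      ∑ {m} (λ k → 0ℝ)               ≈⟨ ∑-const m 0ℝ ⟩
      fromℚ (ι m) * 0ℝ               ≈⟨ pointwise-≃ (λ k → ℚₚ.*-zeroʳ (ι m)) ⟩
      0ℝ                             ∎)
    , λ i j → un≤ (begin
      x i - x j                                   ≈⟨ +-cong ⌊ x≋ i ⌋ (-‿cong ⌊ x≋ j ⌋) ⟩
      ∑ (λ k → y k i) - ∑ (λ k → y k j)           ≈⟨ ≃-sym (∑-- (λ k → y k i) (λ k → y k j)) ⟩
      ∑ (λ k → y k i - y k j)                     ≤⟨ ∑-mono {g = λ k → e k i j} (λ k → ⌊ proj₂ (P⊆ k (y∈P k)) i j ⌋) ⟩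
      ∑ (λ k → e k i j)                           ∎)

  LIP-resp : ∀ {n} {d e : Fin n → Fin n → ℝ} → (∀ i j → d i j ≃ e i j) → LIP d ⊆ LIP e
  LIP-resp {d = d} {e} d≃e {x} (∑x≈0 , x∈) = ∑x≈0 , λ i j → un≤ (begin
    x i - x j   ≤⟨ ⌊ x∈ i j ⌋ ⟩
    d i j       ≈⟨ d≃e i j ⟩
    e i j       ∎)

  MinkowskiSum-mono : ∀ {m n} {P Q : Fin m → PointSet n} → (∀ k → P k ⊆ Q k) → MinkowskiSum P ⊆ MinkowskiSum Q
  MinkowskiSum-mono P⊆Q (y , y∈P , x≋) = y , (λ k → P⊆Q k (y∈P k)) , x≋

  scale-combination : ∀ {n} (a : ℝ) (p q : ℝ^ n) (c : Fin 2 → ℝ) i →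
    a * ∑ᵛ (λ k → c k · (p VF.∷ q VF.∷ VF.[]) k) i ≃ ∑ᵛ (λ k → c k · (a · p VF.∷ a · q VF.∷ VF.[]) k) i
  scale-combination a p q c i = pointwise-≃ λ k → solve 5 (λ a c c′ p q →
    a :* (c :* p :+ (c′ :* q :+ con 0ℚ)) := c :* (a :* p) :+ (c′ :* (a :* q) :+ con 0ℚ)) ≡.refl
    (seq a k) (seq (c zero) k) (seq (c (suc zero)) k) (seq (p i) k) (seq (q i) k)

  -- The same convex coefficients serve on both sides. This makes each weighted S_σ a segment, hence
  -- a generator of the zonotope.
  ⋆-segment : ∀ {n} a (p q : ℝ^ n) → a ⋆ segment p q ≐ segment (a · p) (a · q)
  ⋆-segment a p q =
    (λ { {x} (y , (c , c≥0 , ∑c≈1 , y≋) , x≋) → c , c≥0 , ∑c≈1 , λ i → un≈ (begin-equality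
        x i                                                     ≈⟨ ⌊ x≋ i ⌋ ⟩
        a * y i                                                 ≈⟨ *-cong (≃-refl {a}) ⌊ y≋ i ⌋ ⟩
        a * ∑ᵛ (λ k → c k · (p VF.∷ q VF.∷ VF.[]) k) i          ≈⟨ scale-combination a p q c i ⟩
        ∑ᵛ (λ k → c k · (a · p VF.∷ a · q VF.∷ VF.[]) k) i      ∎) })
    , λ { {x} (c , c≥0 , ∑c≈1 , x≋) → ∑ᵛ (λ k → c k · (p VF.∷ q VF.∷ VF.[]) k)
      , (c , c≥0 , ∑c≈1 , λ i → un≈ (≃-refl {∑ᵛ (λ k → c k · (p VF.∷ q VF.∷ VF.[]) k) i}))
      , λ i → un≈ (≃-trans {x i} ⌊ x≋ i ⌋ (≃-sym (scale-combination a p q c i))) }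

-- One split at a time

-- An inequality of four-point type relative to a split. The arguments are ordered as the four
-- values of `e` arise when a lower bound on β meets an upper one.
Quartet : ∀ {n} → (Fin n → Bool) → (Fin n → Fin n → ℝ) → Set
Quartet s e = ∀ i i′ j j′ → s i ≡ true → s i′ ≡ true → s j ≡ false → s j′ ≡ false →
  e i i′ + e j′ j ≲ e i j + e j′ i′

opaque

  -- β is the largest lower bound imposed by the pairs (i , j) with s i = true and
  -- s j = false; the quartet condition says that it respects all the upper bounds.
  splitting-slope : ∀ {n} (s : Fin n → Bool) {a} (e : Fin n → Fin n → ℝ) (x : ℝ^ n) →
    0ℝ ≲ a → Quartet s e → (∀ i j → x i - x j ≲ a * separation (s i) (s j) + e i j) →
    ∃[ β ] (- a ≲ β) × (β ≲ a) × (∀ i j → (x i - x j) - β * (bit (s i) - bit (s j)) ≲ e i j)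
  splitting-slope {n} s {a} e x 0≤a quartet x∈ = β , -a≤β , β≤a , λ i j → bound i j (s i) (s j) ≡.refl ≡.refl
    where
    slack : Fin n → Fin n → ℝ
    slack i j = x i - x j - e i j

    -- For literal sides `separation p q` computes to 0 or 1, as the ring identities below
    -- presuppose.
    x∈′ : ∀ i j {p q} → s i ≡ p → s j ≡ q → x i - x j ≲ a * separation p q + e i j
    x∈′ i j ≡.refl ≡.refl = x∈ i j

    row : ∀ i → Supremum (λ j → not (s j)) (- a) (slack i)
    row i = supremum (λ j → not (s j)) (- a) (slack i)

    column : Supremum s (- a) (λ i → Supremum.value (row i))
    column = supremum s (- a) (λ i → Supremum.value (row i))

    β : ℝ
    β = Supremum.value column

    -a≤β : - a ≲ β
    -a≤β = Supremum.base column

    slack≤β : ∀ {i j} → s i ≡ true → s j ≡ false → slack i j ≲ β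
    slack≤β {i} {j} si sj = ≲-trans (Supremum.upper (row i) j (≡.cong not sj)) (Supremum.upper column i si)

    β-least : ∀ {u} → - a ≲ u → (∀ {i j} → s i ≡ true → s j ≡ false → slack i j ≲ u) → β ≲ u
    β-least -a≤u slack≤u = Supremum.least column -a≤u λ i si →
      Supremum.least (row i) -a≤u λ j sj → slack≤u si (not-injective sj)

    β≤a : β ≲ a
    β≤a = β-least
      -- The base satisfies -a ≤ a because a ≥ 0; a crossing pair has x i - x j ≤ a + e(i,j), so its
      -- slack is at most a.
      (≲-shift (+-mono-≲ 0≤a 0≤a) λ k →
        solve 1 (λ a → (a :+ a) :- (con 0ℚ :+ con 0ℚ) := a :- (:- a)) ≡.refl (seq a k))
      λ {i} {j} si sj → ≲-shift (x∈′ i j si sj) λ k →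
        solve 4 (λ a x y e → (a :* con 1ℚ :+ e) :- (x :- y) := a :- (x :- y :- e)) ≡.refl
          (seq a k) (seq (x i) k) (seq (x j) k) (seq (e i j) k)

    β≤ : ∀ {i j} → s i ≡ false → s j ≡ true → β ≲ e i j - (x i - x j)
    β≤ {i} {j} si sj = β-least
      -- The pair from B to A crosses σ as well: x i - x j ≤ a + e(i,j) puts the base -a below this
      -- upper bound.
      (≲-shift (x∈′ i j si sj) λ k →
        solve 4 (λ a x y e → (a :* con 1ℚ :+ e) :- (x :- y) := (e :- (x :- y)) :- (:- a)) ≡.refl
          (seq a k) (seq (x i) k) (seq (x j) k) (seq (e i j) k))
      -- With the ends exchanged, (i′, j) and (i, j′) each stay on one side, so `a` occurs with
      -- factor 0.
      λ {i′} {j′} si′ sj′ → ≲-shift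
        (+-mono-≲ (+-mono-≲ (x∈′ i′ j si′ sj) (x∈′ i j′ si sj′)) (quartet i′ j j′ i si′ sj sj′ si)) λ k →
        solve 9 (λ a x y x′ y′ e₁ e₂ e₃ e₄ →
          ((a :* con 0ℚ :+ e₁) :+ (a :* con 0ℚ :+ e₂)) :+ (e₃ :+ e₄)
            :- (((x′ :- y) :+ (x :- y′)) :+ (e₁ :+ e₂))
          := (e₄ :- (x :- y)) :- (x′ :- y′ :- e₃)) ≡.refl
          (seq a k) (seq (x i) k) (seq (x j) k) (seq (x i′) k) (seq (x j′) k)
          (seq (e i′ j) k) (seq (e i j′) k) (seq (e i′ j′) k) (seq (e i j) k)

    bound : ∀ i j p q → s i ≡ p → s j ≡ q → (x i - x j) - β * (bit p - bit q) ≲ e i j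
    bound i j true true si sj = ≲-shift (x∈′ i j si sj) λ k →
      solve 5 (λ a β x y e → (a :* con 0ℚ :+ e) :- (x :- y)
        := e :- ((x :- y) :- β :* (con 1ℚ :- con 1ℚ))) ≡.refl
        (seq a k) (seq β k) (seq (x i) k) (seq (x j) k) (seq (e i j) k)
    bound i j false false si sj = ≲-shift (x∈′ i j si sj) λ k →
      solve 5 (λ a β x y e → (a :* con 0ℚ :+ e) :- (x :- y)
        := e :- ((x :- y) :- β :* (con 0ℚ :- con 0ℚ))) ≡.refl
        (seq a k) (seq β k) (seq (x i) k) (seq (x j) k) (seq (e i j) k)
    bound i j true false si sj = ≲-shift (slack≤β si sj) λ k →
      solve 4 (λ β x y e → β :- (x :- y :- e) := e :- ((x :- y) :- β :* (con 1ℚ :- con 0ℚ))) ≡.refl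
        (seq β k) (seq (x i) k) (seq (x j) k) (seq (e i j) k)
    bound i j false true si sj = ≲-shift (β≤ si sj) λ k →
      solve 4 (λ β x y e → (e :- (x :- y)) :- β := e :- ((x :- y) :- β :* (con 0ℚ :- con 1ℚ))) ≡.refl
        (seq β k) (seq (x i) k) (seq (x j) k) (seq (e i j) k)

  LIP-split : ∀ {n} (σ : Split n) {a} → 0ℝ < a → (e : Fin n → Fin n → ℝ) → Quartet (side σ) e →
    ∀ {x} → LIP (λ i j → a * δ σ i j + e i j) x → ∃[ y ] (a ⋆ S⟨ σ ⟩) y × LIP e (x ⊖ y)
  LIP-split {n} σ {a} 0<a e quartet {x} (∑x≈0 , x∈) =
    let β , -a≤β , β≤a , bound = splitting-slope (side σ) e x (<⇒≲ 0<a) quartet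
          (λ i j → ≡.subst (λ s → x i - x j ≲ a * s + e i j) (δ≡separation σ i j) ⌊ x∈ i j ⌋)
        -- `a ⋆ S⟨ σ ⟩` asks for a point of the unscaled segment, so β is divided by `a`, and -a ≤ β
        -- ≤ a becomes -1 ≤ t ≤ 1.
        r , 0≤r , ar≃1 = inverse 0<a
        t = r * β
        y = a · (t · direction σ)

        -1≤t : - 1ℝ ≲ t
        -1≤t = begin
          - 1ℝ            ≈⟨ -‿cong (≃-sym ar≃1) ⟩
          - (a * r)       ≈⟨ pointwise-≃ (λ k → solve 2 (λ a r → :- (a :* r) := r :* (:- a)) ≡.refl (seq a k) (seq r k)) ⟩
          r * (- a)       ≤⟨ *-monoˡ-≲ 0≤r -a≤β ⟩
          t               ∎

        t≤1 : t ≲ 1ℝ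
        t≤1 = begin
          t               ≤⟨ *-monoˡ-≲ 0≤r β≤a ⟩
          r * a           ≈⟨ pointwise-≃ (λ k → ℚₚ.*-comm (seq r k) (seq a k)) ⟩
          a * r           ≈⟨ ar≃1 ⟩
          1ℝ              ∎

        y∈ : (a ⋆ S⟨ σ ⟩) y
        y∈ = t · direction σ , direction⇒S σ -1≤t t≤1 , λ i → un≈ (≃-refl {y i})

        y≃ : ∀ i → y i ≃ β * direction σ i
        y≃ i = begin-equality
          a * ((r * β) * direction σ i)     ≈⟨ pointwise-≃ (λ k →
            solve 4 (λ a r β u → a :* ((r :* β) :* u) := (a :* r) :* (β :* u)) ≡.refl
              (seq a k) (seq r k) (seq β k) (seq (direction σ i) k)) ⟩
          (a * r) * (β * direction σ i)     ≈⟨ *-cong ar≃1 (≃-refl {β * direction σ i}) ⟩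
          1ℝ * (β * direction σ i)          ≈⟨ pointwise-≃ (λ k → ℚₚ.*-identityˡ (seq (β * direction σ i) k)) ⟩
          β * direction σ i                 ∎

        ∑≃0 : ∑ (x ⊖ y) ≃ 0ℝ
        ∑≃0 = begin-equality
          ∑ (x ⊖ y)          ≈⟨ ∑-- x y ⟩
          ∑ x - ∑ y          ≈⟨ +-cong ⌊ ∑x≈0 ⌋ (-‿cong (≃-trans (sum-cong-≋ {x = y} y≃) (∑-multiple σ β))) ⟩
          0ℝ - 0ℝ            ≈⟨ pointwise-≃ (λ k → ≡.refl) ⟩
          0ℝ                 ∎

        diff : ∀ i j → (x ⊖ y) i - (x ⊖ y) j ≲ e i j
        diff i j = begin
          (x i - y i) - (x j - y j)
            ≈⟨ pointwise-≃ (λ k → solve 4 (λ x x′ y y′ → (x :- y) :- (x′ :- y′) := (x :- x′) :- (y :- y′)) ≡.refl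
                 (seq (x i) k) (seq (x j) k) (seq (y i) k) (seq (y j) k)) ⟩
          (x i - x j) - (y i - y j)
            ≈⟨ +-cong (≃-refl {x i - x j}) (-‿cong (+-cong (y≃ i) (-‿cong (y≃ j)))) ⟩
          (x i - x j) - (β * direction σ i - β * direction σ j)
            ≈⟨ +-cong (≃-refl {x i - x j}) (-‿cong (direction-diff σ i j β)) ⟩
          (x i - x j) - β * (bit (side σ i) - bit (side σ j))
            ≤⟨ bound i j ⟩
          e i j ∎
    in y , y∈ , un≈ ∑≃0 , λ i j → un≤ (diff i j)

  -- An empty intersection puts a whole side of σ into one side of τ, so τ separates nothing there.
  -- The first two cases of compatibility settle the pair in A, the last two the pair in B.
  compatible-sides : ∀ {n} (σ τ : Split n) → Compatible σ τ → ∀ i i′ j j′ →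
    side σ i ≡ true → side σ i′ ≡ true → side σ j ≡ false → side σ j′ ≡ false →
    side τ i ≡ side τ i′ ⊎ side τ j ≡ side τ j′
  compatible-sides σ τ compatible i i′ j j′ si si′ sj sj′ = cases compatible
    where
    module σ = Split σ
    module τ = Split τ

    i∈A : i ∈ σ.A
    i∈A = does⇒∈ i σ.A si

    i′∈A : i′ ∈ σ.A
    i′∈A = does⇒∈ i′ σ.A si′

    j∈B : j ∈ σ.B
    j∈B = side-false⇒∈B σ j sj

    j′∈B : j′ ∈ σ.B
    j′∈B = side-false⇒∈B σ j′ sj′

    outside-A : ∀ {h h′ C} → Empty (C ∩ τ.A) → h ∈ C → h′ ∈ C → side τ h ≡ side τ h′
    outside-A {h} {h′} {C} empty h∈C h′∈C =
      ≡.trans (empty-∩ h C τ.A empty h∈C) (≡.sym (empty-∩ h′ C τ.A empty h′∈C))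

    outside-B : ∀ {h h′ C} → Empty (C ∩ τ.B) → h ∈ C → h′ ∈ C → side τ h ≡ side τ h′
    outside-B {h} {h′} {C} empty h∈C h′∈C = not-injective (≡.trans
      (≡.trans (≡.sym (does-B τ h)) (empty-∩ h C τ.B empty h∈C))
      (≡.sym (≡.trans (≡.sym (does-B τ h′)) (empty-∩ h′ C τ.B empty h′∈C))))

    cases : Compatible σ τ → side τ i ≡ side τ i′ ⊎ side τ j ≡ side τ j′
    cases (inj₁ AA)               = inj₁ (outside-A AA i∈A i′∈A)
    cases (inj₂ (inj₁ AB))        = inj₁ (outside-B AB i∈A i′∈A)
    cases (inj₂ (inj₂ (inj₁ BA))) = inj₂ (outside-A BA j∈B j′∈B)
    cases (inj₂ (inj₂ (inj₂ BB))) = inj₂ (outside-B BB j∈B j′∈B)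

  δ-quartet : ∀ {n} (σ τ : Split n) → Compatible σ τ → Quartet (side σ) (δ τ)
  δ-quartet σ τ compatible i i′ j j′ si si′ sj sj′ = begin
    δ τ i i′ + δ τ j′ j
      ≡⟨ ≡.cong₂ _+_ (δ≡separation τ i i′) (δ≡separation τ j′ j) ⟩
    separation (side τ i) (side τ i′) + separation (side τ j′) (side τ j)
      ≤⟨ separation-quartet (side τ i) (side τ i′) (side τ j) (side τ j′)
           (compatible-sides σ τ compatible i i′ j j′ si si′ sj sj′) ⟩
    separation (side τ i) (side τ j) + separation (side τ j′) (side τ i′)
      ≡⟨ ≡.sym (≡.cong₂ _+_ (δ≡separation τ i j) (δ≡separation τ j′ i′)) ⟩
    δ τ i j + δ τ j′ i′ ∎

  -- The inequality is linear in the function, so it survives nonnegative combinations.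
  d-quartet : ∀ {m n} (σ : Split n) (S : Fin m → Split n) (α : Fin m → ℝ) →
    (∀ k → Compatible σ (S k)) → (∀ k → 0ℝ ≲ α k) → Quartet (side σ) d[ S , α ]
  d-quartet σ S α compatible 0≤α i i′ j j′ si si′ sj sj′ = begin
    d[ S , α ] i i′ + d[ S , α ] j′ j
      ≈⟨ ≃-sym (∑-distrib-+ (λ k → α k * δ (S k) i i′) (λ k → α k * δ (S k) j′ j)) ⟩
    ∑ (λ k → α k * δ (S k) i i′ + α k * δ (S k) j′ j)
      ≤⟨ ∑-mono {f = λ k → α k * δ (S k) i i′ + α k * δ (S k) j′ j}
                {g = λ k → α k * δ (S k) i j + α k * δ (S k) j′ i′} (λ k → begin
        α k * δ (S k) i i′ + α k * δ (S k) j′ j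
          ≈⟨ distrib (α k) (δ (S k) i i′) (δ (S k) j′ j) ⟩
        α k * (δ (S k) i i′ + δ (S k) j′ j)
          ≤⟨ *-monoˡ-≲ (0≤α k) (δ-quartet σ (S k) (compatible k) i i′ j j′ si si′ sj sj′) ⟩
        α k * (δ (S k) i j + δ (S k) j′ i′)
          ≈⟨ ≃-sym (distrib (α k) (δ (S k) i j) (δ (S k) j′ i′)) ⟩
        α k * δ (S k) i j + α k * δ (S k) j′ i′ ∎) ⟩
    ∑ (λ k → α k * δ (S k) i j + α k * δ (S k) j′ i′)
      ≈⟨ ∑-distrib-+ (λ k → α k * δ (S k) i j) (λ k → α k * δ (S k) j′ i′) ⟩
    d[ S , α ] i j + d[ S , α ] j′ i′ ∎
    where
    distrib : ∀ a b c → a * b + a * c ≃ a * (b + c)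
    distrib a b c = pointwise-≃ λ k → ≡.sym (ℚₚ.*-distribˡ-+ (seq a k) (seq b k) (seq c k))

  -- Base of the induction, with no split left: the constraints make x constant, and n times the
  -- constant is the coordinate sum 0. The index `i` witnesses that n is nonzero, so n can be
  -- divided out.
  LIP-zero : ∀ {n} {x : ℝ^ n} → LIP (λ _ _ → 0ℝ) x → ∀ i → x i ≃ 0ℝ
  LIP-zero {n} {x} (∑x≈0 , x∈) i = begin-equality
    x i                                       ≈⟨ pointwise-≃ (λ k → ≡.trans (≡.sym (ℚₚ.*-identityˡ (seq (x i) k)))
      (≡.trans (≡.cong (ℚ._* seq (x i) k) (≡.sym (/-*-ι 1 n {{n≢0}}))) (ℚₚ.*-assoc r (ι n) (seq (x i) k)))) ⟩
    fromℚ r * (fromℚ (ι n) * x i)             ≈⟨ *-cong (≃-refl {fromℚ r}) (begin-equality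
      fromℚ (ι n) * x i    ≈⟨ ≃-sym (∑-const n (x i)) ⟩
      ∑ {n} (λ _ → x i)    ≈⟨ sum-cong-≋ {y = x} (λ j → ≲-antisym (x≤ i j) (x≤ j i)) ⟩
      ∑ x                  ≈⟨ ⌊ ∑x≈0 ⌋ ⟩
      0ℝ                   ∎) ⟩
    fromℚ r * 0ℝ                              ≈⟨ pointwise-≃ (λ k → ℚₚ.*-zeroʳ r) ⟩
    0ℝ                                        ∎
    where
    n≢0 : ℕ.NonZero n
    n≢0 = nonZeroIndex i

    r : ℚ
    r = (+ 1 ℚ./ n) {{n≢0}}

    x-x≤0 : ∀ i j → x i - x j ≲ 0ℝ
    x-x≤0 i j = ⌊ x∈ i j ⌋

    x≤ : ∀ i j → x i ≲ x j
    x≤ i j = ≲-shift (x-x≤0 i j) λ k →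
      solve 2 (λ x y → con 0ℚ :- (x :- y) := y :- x) ≡.refl (seq (x i) k) (seq (x j) k)

  MinkowskiSum-cons : ∀ {m n} (P : Fin (ℕ.suc m) → PointSet n) {x y} →
    P zero y → MinkowskiSum (λ k → P (suc k)) (x ⊖ y) → MinkowskiSum P x
  MinkowskiSum-cons P {x} {y} y∈P (ys , ys∈P , x-y≋) = (y VF.∷ ys)
    , (λ { zero → y∈P ; (suc k) → ys∈P k })
    , λ i → un≈ (begin-equality
      x i                              ≈⟨ pointwise-≃ (λ k →
        solve 2 (λ x y → x := y :+ (x :- y)) ≡.refl (seq (x i) k) (seq (y i) k)) ⟩
      y i + (x i - y i)                ≈⟨ +-cong (≃-refl {y i}) ⌊ x-y≋ i ⌋ ⟩
      y i + ∑ (λ k → ys k i)           ∎)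

  -- Induction on the number of splits. `d[ S , α ]` unfolds to the term of the first split plus the
  -- pseudometric of the others, the form `LIP-split` takes, and the tail inherits pairwise
  -- compatibility.
  LIP⊆MinkowskiSum : ∀ {m n} (S : Fin m → Split n) (α : Fin m → ℝ) →
    (∀ k l → Compatible (S k) (S l)) → (∀ k → 0ℝ < α k) →
    LIP d[ S , α ] ⊆ MinkowskiSum (λ k → α k ⋆ S⟨ S k ⟩)
  LIP⊆MinkowskiSum {ℕ.zero}  S α compatible 0<α {x} x∈ = (λ ()) , (λ ()) , λ i → un≈ (LIP-zero {x = x} x∈ i)
  LIP⊆MinkowskiSum {ℕ.suc m} S α compatible 0<α {x} x∈ =
    let S′ = λ k → S (suc k)
        α′ = λ k → α (suc k)
        y , y∈ , x-y∈ = LIP-split (S zero) {α zero} (0<α zero) d[ S′ , α′ ]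
          (d-quartet (S zero) S′ α′ (λ k → compatible zero (suc k)) (λ k → <⇒≲ (0<α (suc k)))) {x} x∈
    in MinkowskiSum-cons (λ k → α k ⋆ S⟨ S k ⟩) {x} {y} y∈
         (LIP⊆MinkowskiSum S′ α′ (λ k l → compatible (suc k) (suc l)) (λ k → 0<α (suc k)) {x ⊖ y} x-y∈)

-- Both inclusions for the given pseudometric, and the segments generating the zonotope.

mainTheorem4 : ∀ {n : ℕ} (d : Fin n → Fin n → ℝ) → IsPseudometric d → TreeLike d →
    ∀ {m : ℕ} (S : Fin m → Split n) (α : Fin m → ℝ) →
    IsCompatibleSplitSystem S → (∀ k → 0ℝ < α k) →
    (∀ i j → d i j ≈ d[ S , α ] i j) →
    (LIP d ≐ MinkowskiSum (λ k → α k ⋆ S⟨ S k ⟩)) × IsZonotope (LIP d)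
mainTheorem4 {n} d _ _ {m} S α compatible 0<α d≈ =
  (LIP⊆sum , sum⊆LIP)
  , m , (λ k → α k · endpoint⁺ (S k)) , (λ k → α k · endpoint⁻ (S k))
  , (λ {x} x∈ → MinkowskiSum-mono (λ k {y} → proj₁ (segment≐ k) {y}) {x} (LIP⊆sum {x} x∈))
  , (λ {x} x∈ → sum⊆LIP {x} (MinkowskiSum-mono (λ k {y} → proj₂ (segment≐ k) {y}) {x} x∈))
  where
  LIP⊆sum : LIP d ⊆ MinkowskiSum (λ k → α k ⋆ S⟨ S k ⟩)
  LIP⊆sum {x} x∈ = LIP⊆MinkowskiSum S α (IsCompatibleSplitSystem.compatible compatible) 0<α {x}
    (LIP-resp {d = d} {d[ S , α ]} (λ i j → ⌊ d≈ i j ⌋) {x} x∈)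

  sum⊆LIP : MinkowskiSum (λ k → α k ⋆ S⟨ S k ⟩) ⊆ LIP d
  sum⊆LIP {x} x∈ = LIP-resp {d = d[ S , α ]} {d} (λ i j → ≃-sym {d i j} ⌊ d≈ i j ⌋) {x}
    (MinkowskiSum-LIP {e = λ k i j → α k * δ (S k) i j}
      (λ k {y} → ⋆-LIP {a = α k} {S⟨ S k ⟩} {δ (S k)} (<⇒≲ (0<α k)) (λ {z} → S⊆LIP (S k) {z}) {y}) {x} x∈)

  segment≐ : ∀ k → α k ⋆ S⟨ S k ⟩ ≐ segment (α k · endpoint⁺ (S k)) (α k · endpoint⁻ (S k))
  segment≐ k = ⋆-segment (α k) (endpoint⁺ (S k)) (endpoint⁻ (S k))
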